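{- There are absolute constants $C,C'>0$ such that for all integers $k\ge 2$ and $n\ge k+4$, $$n\left(\frac k2+1\right) \;\le\; M^*_{n,k} \;\le\; n\left(\frac k2+\frac52-\frac1k\right) + C k^2 \;\le\; \frac{nk}{2} + C'(n+k^2).$$
   Context: All graphs are finite, simple and undirected. A $k$-truss is a graph with no isolated vertices in which every edge is contained in at least $k$ triangles. For a graph $G=(V,E)$ and $L\subseteq E$, $G(L)$ is the graph with edge set $L$ and vertex set the set of endpoints of edges of $L$. A graph $G=(V,E)$ is a critical $k$-truss if $G$ is a $k$-truss but $G(E')$ is not a $k$-truss for any non-empty $E'\subsetneq E$. $M^*_{n,k}$ denotes the minimum number of edges in a critical $k$-truss on exactly $n$ vertices, with $M^*_{n,k}=\infty$ if no such graph exists. -}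

module Defs where

open import Data.Fin using (Fin)
open import Data.Fin.Properties using (_<?_)
open import Data.Fin.Subset using (Subset; _∈_; _∉_; _∩_; ∣_∣; Nonempty)
open import Data.Fin.Subset.Properties using (nonempty?; _∈?_)
open import Data.Integer using (+_)
open import Data.List using (List; length; filter; allFin; cartesianProduct)
open import Data.Nat using (ℕ; _≤_)
open import Data.Product using (Σ-syntax; ∃-syntax; _×_; _,_)
open import Data.Rational using (ℚ; _/_)
open import Data.Vec using (tabulate)
open import Data.Vec.Properties using (lookup⇒[]=; lookup∘tabulate)
open import Function using (_∘_)
open import Relation.Binary.PropositionalEquality using (_≡_; trans)
open import Relation.Nullary using (¬_; does)
open import Relation.Nullary.Decidable using (_×-dec_; dec-true)

-- A set of unordered pairs of distinct elements of Fin N; the pair {u , v}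
-- belongs to the set iff v ∈ nbr u.
record EdgeSet (N : ℕ) : Set where
  field
    nbr    : Fin N → Subset N
    sym    : ∀ {u v} → v ∈ nbr u → u ∈ nbr v
    irrefl : ∀ {u} → u ∉ nbr u

open EdgeSet public

-- The vertex set is a subset of the ambient label set Fin N, so that a graph
-- and its edge-induced subgraphs G(L) all live in the same type.
record Graph (N : ℕ) : Set where
  field
    V    : Subset N
    E    : EdgeSet N
    ends : ∀ {u v} → v ∈ nbr E u → u ∈ V

open Graph public

-- Each edge is listed once, with its smaller endpoint first.
edges : ∀ {N} → EdgeSet N → List (Fin N × Fin N)
edges {N} L =
  filter (λ (u , v) → (u <? v) ×-dec (v ∈? nbr L u))
         (cartesianProduct (allFin N) (allFin N))

∣E∣ : ∀ {N} → Graph N → ℕ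
∣E∣ G = length (edges (E G))

infix 4 _⊆ₑ_ _⊊ₑ_

_⊆ₑ_ : ∀ {N} → EdgeSet N → EdgeSet N → Set
L ⊆ₑ L′ = ∀ {u v} → v ∈ nbr L u → v ∈ nbr L′ u

_⊊ₑ_ : ∀ {N} → EdgeSet N → EdgeSet N → Set
L ⊊ₑ L′ = (L ⊆ₑ L′) × (∃[ u ] ∃[ v ] (v ∈ nbr L′ u × v ∉ nbr L u))

Nonemptyₑ : ∀ {N} → EdgeSet N → Set
Nonemptyₑ L = ∃[ u ] ∃[ v ] (v ∈ nbr L u)

endpoints : ∀ {N} → EdgeSet N → Subset N
endpoints L = tabulate (does ∘ nonempty? ∘ nbr L)

-- The graph G(L); it depends on L only.
⟨_⟩ : ∀ {N} → EdgeSet N → Graph N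
⟨ L ⟩ = record
  { V    = endpoints L
  ; E    = L
  ; ends = λ {u} {v} uv → lookup⇒[]= u (endpoints L)
      (trans (lookup∘tabulate (does ∘ nonempty? ∘ nbr L) u)
             (dec-true (nonempty? (nbr L u)) (v , uv)))
  }

-- The triangles containing an edge {u , v}, each given by its third vertex.
trianglesOn : ∀ {N} → Graph N → Fin N → Fin N → Subset N
trianglesOn G u v = nbr (E G) u ∩ nbr (E G) v

record IsTruss (k : ℕ) {N : ℕ} (G : Graph N) : Set where
  field
    noIsolated : ∀ {u} → u ∈ V G → Nonempty (nbr (E G) u)
    triangles  : ∀ {u v} → v ∈ nbr (E G) u → k ≤ ∣ trianglesOn G u v ∣

record IsCriticalTruss (k : ℕ) {N : ℕ} (G : Graph N) : Set where
  field
    isTruss : IsTruss k G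
    minimal : ∀ (L : EdgeSet N) → Nonemptyₑ L → L ⊊ₑ E G → ¬ IsTruss k ⟨ L ⟩

-- Up to isomorphism, a graph on exactly n vertices has vertex set all of Fin n.
record CriticalTrussOn (n k : ℕ) : Set where
  field
    graph    : Graph n
    order    : ∣ V graph ∣ ≡ n
    critical : IsCriticalTruss k graph

open CriticalTrussOn public

data ℕ∞ : Set where
  fin : ℕ → ℕ∞
  ∞   : ℕ∞

-- IsM* n k M expresses the equation M*_{n,k} = M.
IsM* : ℕ → ℕ → ℕ∞ → Set
IsM* n k (fin m) = (Σ[ T ∈ CriticalTrussOn n k ] ∣E∣ (graph T) ≡ m)
                 × (∀ (T : CriticalTrussOn n k) → m ≤ ∣E∣ (graph T))
IsM* n k ∞       = ¬ CriticalTrussOn n k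

ι : ℕ → ℚ
ι n = + n / 1

{-# OPTIONS --safe #-}
-- Lower bound. In a truss on more than k + 2 vertices that is critical, no
-- vertex u has degree k + 1: every edge at u would then see all other
-- neighbours of u, so the closed neighbourhood of u would be a complete graph on
-- k + 2 vertices, a smaller truss. Hence all degrees are at least k + 2.
--
-- Upper bound. An edge on exactly k triangles of the graph forces all of those
-- triangles into any sub-truss containing it. For k + 4 ≤ n ≤ 2k + 1 this
-- propagates over the join of a cycle on n − k vertices with the complete graph
-- on k vertices minus a maximum matching; its size is O(k²). For larger n write
-- n = 2 + bk + e with e < k. Take a cycle cut into b arcs, one with 2 + e edges
-- and the others with two, join each arc completely to a clique of k − 2 vertices
-- of its own, and join everything to two non-adjacent hubs. A sub-truss
-- contains a cycle edge, then the next one, and so everything. For e = 0 there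
-- are b(k² + k − 2)/2 + 2(n − 2) edges.
module Submission where

open import Data.Bool using (true; false)
open import Data.Empty using (⊥)
open import Data.Fin as Fin using (Fin; zero; suc; toℕ; fromℕ; fromℕ<; inject₁; combine; remQuot)
open import Data.Fin.Induction using (<-weakInduction-startingFrom)
open import Data.Fin.Properties as Finₚ using (+↔⊎; *↔×; all?; any?; injective⇒≤; remQuot-combine; toℕ-fromℕ; toℕ-fromℕ<; toℕ-inject₁; toℕ-injective; toℕ<n; toℕ≤pred[n])
open import Data.Fin.Relation.Unary.Top using (view; ‵fromℕ; ‵inject₁; view-fromℕ; view-inject₁)
open import Data.Fin.Subset using (Subset; ∣_∣; ⊤; _∩_; Nonempty) renaming (_∈_ to _∈ₛ_)
open import Data.Fin.Subset.Properties using (∈⊤; ∣⊤∣≡n; ∣p∣≡n⇒p≡⊤; nonempty?; anySubset?; ⊆-antisym; x∈p∩q⁺; x∈p∩q⁻) renaming (_∈?_ to _∈ₛ?_)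
import Data.Integer.Properties as ℤₚ
open import Data.List using (List; []; _∷_; _++_; map; length; lookup; filter; allFin; cartesianProduct; cartesianProductWith)
open import Data.List.Membership.Propositional using (_∈_; _∉_; find)
open import Data.List.Membership.Propositional.Properties
open import Data.List.Properties using (filter-≐; length-map; length-++; length-tabulate)
open import Data.List.Relation.Unary.All as All using (All; []; _∷_)
import Data.List.Relation.Unary.All.Properties as Allₚ
open import Data.List.Relation.Unary.AllPairs using ([]; _∷_)
open import Data.List.Relation.Unary.Any as Any using (here; there)
open import Data.List.Relation.Unary.Any.Properties using (lookup-index)
open import Data.List.Relation.Unary.Unique.Propositional using (Unique)
import Data.List.Relation.Unary.Unique.Propositional.Properties as Uniqueₚ
open import Data.Nat using (ℕ; zero; suc; z≤n; s≤s)
open import Data.Nat.DivMod using (_divMod_; result)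
open import Data.Nat.Induction using (<-rec)
open import Data.Nat.Properties as ℕ using (<⇒≤; ≤-trans; ≤-refl; anyUpTo?)
open import Data.Nat.Tactic.RingSolver using (solve-∀)
open import Data.Product using (∃; Σ-syntax; ∃-syntax; _×_; _,_; proj₁; proj₂; swap; uncurry)
open import Data.Product.Properties using (,-injective) renaming (≡-dec to ×-≡-dec)
open import Data.Rational.Properties as ℚₚ using (toℚᵘ-injective; toℚᵘ-fromℚᵘ; fromℚᵘ-cong; toℚᵘ-cancel-≤)
open import Data.Rational.Solver using (module +-*-Solver)
open import Data.Rational.Unnormalised as ℚᵘ using (mkℚᵘ; *≡*; *≤*)
import Data.Rational.Unnormalised.Properties as ℚᵘₚ
open import Data.Sum using (_⊎_; inj₁; inj₂)
open import Data.Sum.Function.Propositional using (_⊎-↔_)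
open import Data.Sum.Properties using (inj₁-injective; inj₂-injective) renaming (≡-dec to ⊎-≡-dec)
open import Data.Unit using (tt) renaming (⊤ to Unit)
open import Data.Vec using ([]; _∷_; here; there; tabulate)
open import Data.Vec.Properties using (lookup⇒[]=; []=⇒lookup; lookup∘tabulate)
open import Function using (_∘_; id; _↔_; Inverse)
open import Function.Construct.Composition using (_↔-∘_)
open import Function.Properties.Inverse using (↔-sym; ↔-refl)
open import Relation.Binary using (DecidableEquality; tri<; tri≈; tri>)
open import Relation.Binary.PropositionalEquality using (_≡_; _≢_; refl; sym; trans; cong; cong₂; subst; subst₂)
open import Relation.Nullary using (¬_; Dec; does; yes; no; contradiction)
open import Relation.Nullary.Decidable using (decidable-stable; ¬?; _×-dec_; _⊎-dec_; _→-dec_; dec-true; map′)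
open import Relation.Unary using (Decidable)
open import Defs hiding (sym)

-- Exact counts shape the chain. The hubs are non-adjacent because a hub and an inner vertex of an
-- arc already share two cycle neighbours and κ = k - 2 locals; an edge between the hubs would add a
-- further triangle and spoil the tightness. Arcs have two edges because a hub and a local share
-- only κ - 1 other locals and so need three cycle vertices. With a single arc, every edge from a
-- cycle vertex to a local would lie on k + 1 triangles; so b ≥ 2 and n ≥ 2k + 2, which is why
-- smaller n needs another construction. The obstacle is the junction of two arcs: its vertex sees
-- the locals of both, so its hub edges need not be tight. There the old arc accounts for only k - 1
-- common neighbours, and the one that must exist beyond them leads into the new arc.

module _ where
  open import Data.Nat using (pred; >-nonZero; _+_; _*_; _≤_; _<_; _≤?_)

  private
    variable
      A B : Set
      P Q : A → Set
      xs ys zs : List A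
      k m n : ℕ

  -- Counting with duplicate-free lists

  lookup-injective : Unique xs → ∀ {i j} → lookup xs i ≡ lookup xs j → i ≡ j
  lookup-injective (_ ∷ _) {zero} {zero} _ = refl
  lookup-injective (x∉ ∷ _) {zero} {suc j} eq = contradiction eq (All.lookup x∉ (∈-lookup j))
  lookup-injective (x∉ ∷ _) {suc i} {zero} eq = contradiction (sym eq) (All.lookup x∉ (∈-lookup i))
  lookup-injective (_ ∷ u) {suc i} {suc j} eq = cong suc (lookup-injective u eq)

  Unique-⊆⇒length≤ : Unique xs → (∀ {x} → x ∈ xs → x ∈ ys) → length xs ≤ length ys
  Unique-⊆⇒length≤ {xs = xs} {ys = ys} u sub = injective⇒≤ {f = λ i → Any.index (sub (∈-lookup i))} λ {i} {j} eq →
    lookup-injective u (trans (lookup-index (sub (∈-lookup i)))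
      (trans (cong (lookup ys) eq) (sym (lookup-index (sub (∈-lookup j))))))

  -- A list as witness makes sense over any type, so triangles can be counted on sums and products
  -- of index types before any labelling by `Fin n`.
  AtLeast : ℕ → (A → Set) → Set
  AtLeast k P = ∃ λ xs → Unique xs × All P xs × k ≤ length xs

  AtLeast-map : (f : A → B) → (∀ {x y} → f x ≡ f y → x ≡ y) → (∀ {x} → P x → Q (f x)) →
                AtLeast k P → AtLeast k Q
  AtLeast-map f inj pq (xs , u , p , k≤) =
    map f xs , Uniqueₚ.map⁺ inj u , Allₚ.map⁺ (All.map pq p) , subst (_ ≤_) (sym (length-map f xs)) k≤

  AtLeast-⊆ : (∀ {x} → P x → Q x) → AtLeast k P → AtLeast k Q
  AtLeast-⊆ pq (xs , u , p , k≤) = xs , u , All.map pq p , k≤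

  -- Filtering `ys` loses at most the exceptions `zs`. Repetitions in `zs` are allowed: a hub that
  -- is its own mate will be listed twice.
  AtLeast-intro : Decidable P → Unique ys → (∀ {y} → y ∈ ys → P y ⊎ y ∈ zs) →
                  k + length zs ≤ length ys → AtLeast k P
  AtLeast-intro {P = P} {ys = ys} {zs = zs} {k = k} P? u split k≤ =
    filter P? ys , Uniqueₚ.filter⁺ P? u , Allₚ.all-filter P? ys ,
    ℕ.+-cancelʳ-≤ (length zs) k _ (≤-trans k≤ (subst (_ ≤_) (length-++ (filter P? ys))
      (Unique-⊆⇒length≤ u λ y∈ → cover y∈ (split y∈))))
    where
    cover : ∀ {y} → y ∈ ys → P y ⊎ y ∈ zs → y ∈ filter P? ys ++ zs
    cover y∈ (inj₁ p) = ∈-++⁺ˡ (∈-filter⁺ P? y∈ p)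
    cover y∈ (inj₂ y∈zs) = ∈-++⁺ʳ (filter P? ys) y∈zs

  AtLeast-bound : AtLeast k P → (∀ {x} → P x → x ∈ ys) →
                  Unique zs → (∀ {z} → z ∈ zs → ¬ P z × z ∈ ys) → k + length zs ≤ length ys
  AtLeast-bound {ys = ys} {zs = zs} (xs , u , p , k≤) P⊆ys uz zs⊆ =
    ≤-trans (ℕ.+-monoˡ-≤ (length zs) k≤) (subst (_≤ length ys) (length-++ xs)
      (Unique-⊆⇒length≤ (Uniqueₚ.++⁺ u uz λ (x∈ , x∈′) → proj₁ (zs⊆ x∈′) (All.lookup p x∈)) cover))
    where
    cover : ∀ {x} → x ∈ xs ++ zs → x ∈ ys
    cover x∈ with ∈-++⁻ xs x∈
    ... | inj₁ x∈xs = P⊆ys (All.lookup p x∈xs)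
    ... | inj₂ x∈zs = proj₂ (zs⊆ x∈zs)

  -- A further `w` outside `P` could be added to `zs`, against `AtLeast-bound`. This is the
  -- propagation principle: when an edge has only k candidate third vertices, each of them forms a
  -- triangle with it.
  AtLeast-tight : Decidable P → AtLeast k P → (∀ {x} → P x → x ∈ ys) →
                  Unique zs → (∀ {z} → z ∈ zs → ¬ P z × z ∈ ys) → length ys ≤ k + length zs →
                  ∀ {w} → w ∈ ys → w ∉ zs → P w
  AtLeast-tight {P = P} {k = k} {zs = zs} P? many P⊆ys uz zs⊆ ≤k {w} w∈ w∉ =
    decidable-stable (P? w) λ ¬Pw →
      ℕ.<-irrefl refl (≤-trans (ℕ.≤-reflexive (sym (ℕ.+-suc k (length zs))))
        (≤-trans (AtLeast-bound many P⊆ys (All.tabulate (λ z∈ w≡z → w∉ (subst (_∈ zs) (sym w≡z) z∈)) ∷ uz)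
                    λ { (here refl) → ¬Pw , w∈ ; (there z∈) → zs⊆ z∈ }) ≤k))

  -- Witnesses confined to `ys` would contradict `AtLeast-bound`. This is the substitute for
  -- `AtLeast-tight` where there are more than k candidates: it yields one third vertex outside a
  -- list that is too short.
  AtLeast-escape : {A : Set} {P : A → Set} {ys zs : List A} → DecidableEquality A →
                   AtLeast k P → Unique zs → (∀ {z} → z ∈ zs → ¬ P z × z ∈ ys) →
                   length ys < k + length zs → ∃ λ w → P w × w ∉ ys
  AtLeast-escape {P = P} {ys = ys} _≟_ (xs , u , p , k≤) uz zs⊆ <k
    with Any.any? (λ x → ¬? (Any.any? (x ≟_) ys)) xs
  ... | yes out = let w , w∈ , w∉ = find out in w , All.lookup p w∈ , w∉
  ... | no none = contradiction
    (≤-trans <k (AtLeast-bound {P = λ x → P x × x ∈ ys} (xs , u , All.tabulate both , k≤) proj₂ uz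
       λ z∈ → (proj₁ (zs⊆ z∈) ∘ proj₁) , proj₂ (zs⊆ z∈)))
    (ℕ.<-irrefl refl)
    where
    both : ∀ {x} → x ∈ xs → P x × x ∈ ys
    both {x} x∈ = All.lookup p x∈ ,
      decidable-stable (Any.any? (x ≟_) ys) λ x∉ → none (Any.map (λ { refl → x∉ }) x∈)

  elements : Subset n → List (Fin n)
  elements [] = []
  elements (true ∷ p) = zero ∷ map suc (elements p)
  elements (false ∷ p) = map suc (elements p)

  length-elements : (p : Subset n) → length (elements p) ≡ ∣ p ∣
  length-elements [] = refl
  length-elements (true ∷ p) = cong suc (trans (length-map suc (elements p)) (length-elements p))
  length-elements (false ∷ p) = trans (length-map suc (elements p)) (length-elements p)

  ∈-elements⁺ : {p : Subset n} {i : Fin n} → i ∈ₛ p → i ∈ elements p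
  ∈-elements⁺ {p = true ∷ p} here = here refl
  ∈-elements⁺ {p = true ∷ p} (there i∈) = there (∈-map⁺ suc (∈-elements⁺ i∈))
  ∈-elements⁺ {p = false ∷ p} (there i∈) = ∈-map⁺ suc (∈-elements⁺ i∈)

  ∈-elements⁻ : {p : Subset n} {i : Fin n} → i ∈ elements p → i ∈ₛ p
  ∈-elements⁻ {p = true ∷ p} (here refl) = here
  ∈-elements⁻ {p = true ∷ p} (there i∈) with _ , j∈ , refl ← ∈-map⁻ suc i∈ = there (∈-elements⁻ j∈)
  ∈-elements⁻ {p = false ∷ p} i∈ with _ , j∈ , refl ← ∈-map⁻ suc i∈ = there (∈-elements⁻ j∈)

  elements-Unique : (p : Subset n) → Unique (elements p)
  elements-Unique [] = []
  elements-Unique (true ∷ p) =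
    Allₚ.map⁺ (All.tabulate λ _ ()) ∷ Uniqueₚ.map⁺ Finₚ.suc-injective (elements-Unique p)
  elements-Unique (false ∷ p) = Uniqueₚ.map⁺ Finₚ.suc-injective (elements-Unique p)

  AtLeast⇒≤∣p∣ : {p : Subset n} → AtLeast k (_∈ₛ p) → k ≤ ∣ p ∣
  AtLeast⇒≤∣p∣ {p = p} (xs , u , ps , k≤) = ≤-trans k≤
    (subst (length xs ≤_) (length-elements p) (Unique-⊆⇒length≤ u (∈-elements⁺ ∘ All.lookup ps)))

  ≤∣p∣⇒AtLeast : {p : Subset n} → k ≤ ∣ p ∣ → AtLeast k (_∈ₛ p)
  ≤∣p∣⇒AtLeast {p = p} k≤ =
    elements p , elements-Unique p , All.tabulate ∈-elements⁻ , subst (_ ≤_) (sym (length-elements p)) k≤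

  length-cartesianProductWith : {C : Set} (f : A → B → C) (xs : List A) (ys : List B) →
                                length (cartesianProductWith f xs ys) ≡ length xs * length ys
  length-cartesianProductWith f [] ys = refl
  length-cartesianProductWith f (x ∷ xs) ys = trans (length-++ (map (f x) ys))
    (cong₂ _+_ (length-map (f x) ys) (length-cartesianProductWith f xs ys))

  length-allFin : ∀ n → length (allFin n) ≡ n
  length-allFin n = length-tabulate {n = n} id

  ∉⇒All≢ : {x : A} → x ∉ xs → All (x ≢_) xs
  ∉⇒All≢ x∉ = All.tabulate λ y∈ x≡y → x∉ (subst (_∈ _) (sym x≡y) y∈)

  -- Trusses as dense relations, and the lower bound

  ∈-tabulate-does⁺ : {P : Fin n → Set} (P? : Decidable P) → ∀ {i} → P i → i ∈ₛ tabulate (does ∘ P?)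
  ∈-tabulate-does⁺ P? {i} p = lookup⇒[]= i _ (trans (lookup∘tabulate (does ∘ P?) i) (dec-true (P? i) p))

  ∈-tabulate-does⁻ : {P : Fin n → Set} (P? : Decidable P) → ∀ {i} → i ∈ₛ tabulate (does ∘ P?) → P i
  ∈-tabulate-does⁻ P? {i} i∈ with P? i | trans (sym (lookup∘tabulate (does ∘ P?) i)) ([]=⇒lookup i∈)
  ... | yes p | _ = p
  ... | no _ | ()

  -- The vertex type is arbitrary, so that hubs, cycle vertices and locals can be told apart by
  -- pattern matching; a bijection with `Fin n` enters only in `criticalTruss`.
  record Adjacency (A : Set) : Set₁ where
    field
      Adj        : A → A → Set
      adj?       : ∀ a b → Dec (Adj a b)
      adj-sym    : ∀ {a b} → Adj a b → Adj b a
      adj-irrefl : ∀ {a} → ¬ Adj a a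

    Common : A → A → A → Set
    Common a b c = Adj a c × Adj b c

    common? : ∀ a b → Decidable (Common a b)
    common? a b c = adj? a c ×-dec adj? b c

    Dense : ℕ → Set
    Dense k = ∀ {a b} → Adj a b → AtLeast k (Common a b)

  open Adjacency

  -- Minimality in positive form: propagation proves the containment directly, and an edge missing
  -- from a sub-truss then contradicts it.
  Critical : ℕ → Adjacency A → Set₁
  Critical {A} k G = (R : Adjacency A) → (∀ {a b} → Adj R a b → Adj G a b) →
    ∀ {a b} → Adj R a b → Dense R k → ∀ {c d} → Adj G c d → Adj R c d

  pullback : (B → A) → Adjacency A → Adjacency B
  pullback f G = record
    { Adj = λ a b → Adj G (f a) (f b)
    ; adj? = λ a b → adj? G (f a) (f b)
    ; adj-sym = adj-sym G
    ; adj-irrefl = adj-irrefl G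
    }

  toEdgeSet : Adjacency (Fin n) → EdgeSet n
  toEdgeSet G = record
    { nbr = λ u → tabulate (does ∘ adj? G u)
    ; sym = λ {u} {v} uv → ∈-tabulate-does⁺ (adj? G v) (adj-sym G (∈-tabulate-does⁻ (adj? G u) uv))
    ; irrefl = λ {u} uu → adj-irrefl G (∈-tabulate-does⁻ (adj? G u) uu)
    }

  fromEdgeSet : EdgeSet n → Adjacency (Fin n)
  fromEdgeSet L = record
    { Adj = λ u v → v ∈ₛ nbr L u
    ; adj? = λ u v → v ∈ₛ? nbr L u
    ; adj-sym = EdgeSet.sym L
    ; adj-irrefl = irrefl L
    }

  Dense⇒triangles : (L : EdgeSet n) → Dense (fromEdgeSet L) k →
                    ∀ {u v} → v ∈ₛ nbr L u → k ≤ ∣ nbr L u ∩ nbr L v ∣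
  Dense⇒triangles L dense uv = AtLeast⇒≤∣p∣ (AtLeast-⊆ x∈p∩q⁺ (dense uv))

  triangles⇒Dense : (L : EdgeSet n) → (∀ {u v} → v ∈ₛ nbr L u → k ≤ ∣ nbr L u ∩ nbr L v ∣) →
                    Dense (fromEdgeSet L) k
  triangles⇒Dense L triangles {u} {v} uv = AtLeast-⊆ (x∈p∩q⁻ (nbr L u) (nbr L v)) (≤∣p∣⇒AtLeast (triangles uv))

  Dense⇒IsTruss : (L : EdgeSet n) → Dense (fromEdgeSet L) k → IsTruss k ⟨ L ⟩
  Dense⇒IsTruss L dense = record
    { noIsolated = ∈-tabulate-does⁻ (nonempty? ∘ nbr L)
    ; triangles = Dense⇒triangles L dense
    }

  Dense-pullback : {G : Adjacency A} (ϕ : A ↔ B) → Dense G k → Dense (pullback (Inverse.from ϕ) G) k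
  Dense-pullback {G = G} ϕ dense ab =
    AtLeast-map to (λ eq → trans (sym (strictlyInverseʳ _)) (trans (cong from eq) (strictlyInverseʳ _)))
      (λ (p , q) → subst (Adj G _) (sym (strictlyInverseʳ _)) p , subst (Adj G _) (sym (strictlyInverseʳ _)) q)
      (dense ab)
    where open Inverse ϕ

  Dense-cong : {G H : Adjacency A} → (∀ {a b} → Adj G a b → Adj H a b) → (∀ {a b} → Adj H a b → Adj G a b) →
               Dense G k → Dense H k
  Dense-cong G⊆H H⊆G dense ab = AtLeast-⊆ (λ (p , q) → G⊆H p , G⊆H q) (dense (H⊆G ab))

  fullGraph : EdgeSet n → Graph n
  fullGraph L = record { V = ⊤ ; E = L ; ends = λ _ → ∈⊤ }

  module _ (ϕ : A ↔ Fin n) (G : Adjacency A) where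
    open Inverse ϕ

    edgeSet : EdgeSet n
    edgeSet = toEdgeSet (pullback from G)

    ∈edgeSet⁺ : ∀ {u v} → Adj G (from u) (from v) → v ∈ₛ nbr edgeSet u
    ∈edgeSet⁺ {u} = ∈-tabulate-does⁺ (adj? G (from u) ∘ from)

    ∈edgeSet⁻ : ∀ {u v} → v ∈ₛ nbr edgeSet u → Adj G (from u) (from v)
    ∈edgeSet⁻ {u} = ∈-tabulate-does⁻ (adj? G (from u) ∘ from)

    criticalTruss : (∀ a → ∃ (Adj G a)) → Dense G k → Critical k G → CriticalTrussOn n k
    criticalTruss {k} nonIsolated dense critical = record
      { graph = fullGraph edgeSet
      ; order = ∣⊤∣≡n n
      ; critical = record
        { isTruss = record
          { noIsolated = λ {u} _ → let b , ab = nonIsolated (from u) in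
              to b , ∈edgeSet⁺ (subst (Adj G _) (sym (strictlyInverseʳ b)) ab)
          ; triangles = Dense⇒triangles edgeSet
              (Dense-cong {G = pullback from G} {H = fromEdgeSet edgeSet} ∈edgeSet⁺ ∈edgeSet⁻ (Dense-pullback {G = G} ϕ dense))
          }
        ; minimal = λ L (u , v , uv) (L⊆ , u′ , v′ , u′v′ , u′v′∉) truss →
            let R = pullback to (fromEdgeSet L)
                L⇒R : ∀ {u v} → v ∈ₛ nbr L u → Adj R (from u) (from v)
                L⇒R = subst₂ (λ u v → v ∈ₛ nbr L u) (sym (strictlyInverseˡ _)) (sym (strictlyInverseˡ _))
                R⊆G : ∀ {a b} → Adj R a b → Adj G a b
                R⊆G = subst₂ (Adj G) (strictlyInverseʳ _) (strictlyInverseʳ _) ∘ ∈edgeSet⁻ ∘ L⊆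
            in u′v′∉ (subst₂ (λ u v → v ∈ₛ nbr L u) (strictlyInverseˡ _) (strictlyInverseˡ _)
              (critical R R⊆G (L⇒R uv)
                (Dense-pullback {G = fromEdgeSet L} (↔-sym ϕ) (triangles⇒Dense L (IsTruss.triangles truss)))
                (∈edgeSet⁻ u′v′)))
        }
      }

  -- Double counting of edges

  module _ (L : EdgeSet n) where

    edges-Unique : Unique (edges L)
    edges-Unique = Uniqueₚ.filter⁺ _ (Uniqueₚ.cartesianProduct⁺ (Uniqueₚ.allFin⁺ n) (Uniqueₚ.allFin⁺ n))

    ∈-edges⁺ : ∀ {u v} → u Fin.< v → v ∈ₛ nbr L u → (u , v) ∈ edges L
    ∈-edges⁺ u<v uv = ∈-filter⁺ _ (∈-cartesianProduct⁺ (∈-allFin _) (∈-allFin _)) (u<v , uv)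

    ∈-edges⁻ : ∀ {u v} → (u , v) ∈ edges L → u Fin.< v × v ∈ₛ nbr L u
    ∈-edges⁻ uv∈ = proj₂ (∈-filter⁻ _ {xs = cartesianProduct (allFin n) (allFin n)} uv∈)

    darts : List (Fin n × Fin n)
    darts = edges L ++ map swap (edges L)

    darts-Unique : Unique darts
    darts-Unique = Uniqueₚ.++⁺ edges-Unique (Uniqueₚ.map⁺ (λ { refl → refl }) edges-Unique) disjoint
      where
      disjoint : ∀ {uv} → ¬ (uv ∈ edges L × uv ∈ map swap (edges L))
      disjoint (uv∈ , vu∈) with _ , vu∈′ , refl ← ∈-map⁻ swap vu∈ =
        Finₚ.<-asym (proj₁ (∈-edges⁻ uv∈)) (proj₁ (∈-edges⁻ vu∈′))

    ∈-darts⁺ : ∀ {u v} → v ∈ₛ nbr L u → (u , v) ∈ darts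
    ∈-darts⁺ {u} {v} uv with Finₚ.<-cmp u v
    ... | tri< u<v _ _ = ∈-++⁺ˡ (∈-edges⁺ u<v uv)
    ... | tri≈ _ refl _ = contradiction uv (irrefl L)
    ... | tri> _ _ v<u = ∈-++⁺ʳ (edges L) (∈-map⁺ swap (∈-edges⁺ v<u (EdgeSet.sym L uv)))

    ∈-darts⁻ : ∀ {u v} → (u , v) ∈ darts → v ∈ₛ nbr L u
    ∈-darts⁻ uv∈ with ∈-++⁻ (edges L) uv∈
    ... | inj₁ uv∈′ = proj₂ (∈-edges⁻ uv∈′)
    ... | inj₂ vu∈ with _ , vu∈′ , refl ← ∈-map⁻ swap vu∈ = EdgeSet.sym L (proj₂ (∈-edges⁻ vu∈′))

    length-darts : length darts ≡ 2 * length (edges L)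
    length-darts = trans (length-++ (edges L)) (cong (length (edges L) +_)
      (trans (length-map swap (edges L)) (sym (ℕ.+-identityʳ _))))

    manyDarts : AtLeast (2 * length (edges L)) (λ (u , v) → v ∈ₛ nbr L u)
    manyDarts = darts , darts-Unique , All.tabulate ∈-darts⁻ , ℕ.≤-reflexive (sym length-darts)

    handshake-≥ : (∀ u → AtLeast k (_∈ₛ nbr L u)) → n * k ≤ 2 * length (edges L)
    handshake-≥ {k} degree = subst₂ _≤_
      (trans (length-map dart (cartesianProduct (allFin n) (allFin k)))
        (trans (length-cartesianProductWith _,_ (allFin n) (allFin k)) (cong₂ _*_ (length-allFin n) (length-allFin k)))) length-darts
      (Unique-⊆⇒length≤
        (Uniqueₚ.map⁺ dart-injective (Uniqueₚ.cartesianProduct⁺ (Uniqueₚ.allFin⁺ n) (Uniqueₚ.allFin⁺ k))) dart∈)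
      where
      nb : ∀ u → Fin k → Fin n
      nb u i = lookup (proj₁ (degree u)) (Fin.inject≤ i (proj₂ (proj₂ (proj₂ (degree u)))))
      dart : Fin n × Fin k → Fin n × Fin n
      dart (u , i) = u , nb u i
      dart-injective : ∀ {x y} → dart x ≡ dart y → x ≡ y
      dart-injective {u , i} {v , j} eq with refl , eq′ ← ,-injective eq =
        cong (u ,_) (Finₚ.inject≤-injective _ _ i j (lookup-injective (proj₁ (proj₂ (degree u))) eq′))
      dart∈ : ∀ {x} → x ∈ map dart (cartesianProduct (allFin n) (allFin k)) → x ∈ darts
      dart∈ x∈ with (u , i) , _ , refl ← ∈-map⁻ dart x∈ =
        ∈-darts⁺ (All.lookup (proj₁ (proj₂ (proj₂ (degree u)))) (∈-lookup _))

  manyDarts-↔ : (ϕ : A ↔ Fin n) (G : Adjacency A) → AtLeast (2 * length (edges (edgeSet ϕ G))) (uncurry (Adj G))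
  manyDarts-↔ ϕ G = AtLeast-map (λ (u , v) → from u , from v)
    (λ eq → cong₂ _,_ (from-injective (cong proj₁ eq)) (from-injective (cong proj₂ eq)))
    (∈edgeSet⁻ ϕ G) (manyDarts (edgeSet ϕ G))
    where
    open Inverse ϕ
    from-injective : ∀ {u v} → from u ≡ from v → u ≡ v
    from-injective eq = trans (sym (strictlyInverseˡ _)) (trans (cong to eq) (strictlyInverseˡ _))

  module _ (T : CriticalTrussOn n k) where
    open IsCriticalTruss (critical T)
    open IsTruss isTruss
    private
      G = fromEdgeSet (E (graph T))
      open import Data.List.Membership.DecPropositional (Finₚ._≟_ {n}) using (_∈?_)

    V≡⊤ : V (graph T) ≡ ⊤
    V≡⊤ = ∣p∣≡n⇒p≡⊤ (order T)

    neighbour : ∀ u → ∃ (Adj G u)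
    neighbour u = noIsolated (subst (u ∈ₛ_) (sym V≡⊤) ∈⊤)

    k+2≤degree : k + 3 ≤ n → ∀ u → k + 2 ≤ ∣ nbr (E (graph T)) u ∣
    k+2≤degree k+3≤n u = decidable-stable (k + 2 ≤? _) λ k+2≰ →
      let N = nbr (E (graph T)) u
          xs = elements N

          dense : Dense G k
          dense = triangles⇒Dense (E (graph T)) triangles

          length≤ : length xs ≤ k + 1
          length≤ = ℕ.≤-pred (subst₂ _≤_ (cong suc (sym (length-elements N))) (ℕ.+-suc k 1) (ℕ.≰⇒> k+2≰))

          adjacent : ∀ {x y} → x ∈ u ∷ xs → y ∈ u ∷ xs → x ≢ y → Adj G x y
          adjacent = λ
            { (here refl) (here refl) x≢y → contradiction refl x≢y
            ; (here refl) (there y∈) _ → ∈-elements⁻ y∈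
            ; (there x∈) (here refl) _ → adj-sym G (∈-elements⁻ x∈)
            ; {x} {y} (there x∈) (there y∈) x≢y → proj₂
                (AtLeast-tight (common? G u x) (dense (∈-elements⁻ x∈)) (∈-elements⁺ ∘ proj₁)
                  ([] ∷ []) (λ { (here refl) → adj-irrefl G ∘ proj₂ , x∈ }) length≤ y∈ λ { (here y≡x) → x≢y (sym y≡x) })
            }

          v , uv = neighbour u

          k+1≤length : k + 1 ≤ length xs
          k+1≤length = AtLeast-bound {zs = v ∷ []} (dense uv) (∈-elements⁺ ∘ proj₁) ([] ∷ [])
            λ { (here refl) → adj-irrefl G ∘ proj₂ , ∈-elements⁺ uv }

          K : Adjacency (Fin n)
          K = record
            { Adj = λ x y → x ∈ u ∷ xs × y ∈ u ∷ xs × x ≢ y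
            ; adj? = λ x y → (x ∈? (u ∷ xs)) ×-dec (y ∈? (u ∷ xs)) ×-dec ¬? (x Finₚ.≟ y)
            ; adj-sym = λ (x∈ , y∈ , x≢y) → y∈ , x∈ , x≢y ∘ sym
            ; adj-irrefl = λ (_ , _ , x≢x) → x≢x refl
            }

          KE = toEdgeSet K

          K⁺ : ∀ {x y} → Adj K x y → y ∈ₛ nbr KE x
          K⁺ {x} = ∈-tabulate-does⁺ (adj? K x)

          K⁻ : ∀ {x y} → y ∈ₛ nbr KE x → Adj K x y
          K⁻ {x} = ∈-tabulate-does⁻ (adj? K x)

          u∉xs : u ∉ xs
          u∉xs = adj-irrefl G ∘ ∈-elements⁻

          K-dense : Dense K k
          K-dense {x} {y} (x∈ , y∈ , x≢y) = AtLeast-intro {ys = u ∷ xs} {zs = x ∷ y ∷ []} (common? K x y)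
            (∉⇒All≢ u∉xs ∷ elements-Unique N)
            (λ {z} z∈ → split x∈ y∈ z∈ (x Finₚ.≟ z) (y Finₚ.≟ z))
            (subst (_≤ suc (length xs)) (sym (ℕ.+-suc k 1)) (s≤s k+1≤length))

          -- The closed neighbourhood of `u` has at most k + 2 vertices, so n ≥ k + 3 leaves a
          -- vertex `z` outside it. The edge from `z` to a neighbour is missing from `K`, which
          -- makes the inclusion proper.
          z , _ , z∉ = AtLeast-escape {P = λ _ → Unit} {ys = u ∷ xs} {zs = []} Finₚ._≟_
            (allFin n , Uniqueₚ.allFin⁺ n , All.tabulate (λ _ → tt) , ℕ.≤-reflexive (sym (length-allFin n)))
            [] (λ ()) (subst (suc (suc (length xs)) ≤_) (sym (ℕ.+-identityʳ n))
              (≤-trans (s≤s (s≤s length≤)) (subst (_≤ n) (trans (ℕ.+-suc k 2) (cong suc (ℕ.+-suc k 1))) k+3≤n)))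

          y , zy = neighbour z
      in minimal KE
        (u , v , K⁺ (here refl , there (∈-elements⁺ uv) , λ u≡v → adj-irrefl G (subst (Adj G u) (sym u≡v) uv)))
        ((λ xy → let x∈ , y∈ , x≢y = K⁻ xy in adjacent x∈ y∈ x≢y) ,
          z , y , zy , λ zy∈ → z∉ (proj₁ (K⁻ zy∈)))
        (Dense⇒IsTruss KE (λ {a} → Dense-cong {G = K} {H = fromEdgeSet KE} (λ {x} → K⁺ {x}) (λ {x} → K⁻ {x}) (λ {x} → K-dense {x}) {a}))
      where
      split : ∀ {x y z} {ws : List (Fin n)} → x ∈ ws → y ∈ ws → z ∈ ws → Dec (x ≡ z) → Dec (y ≡ z) →
              ((x ∈ ws × z ∈ ws × x ≢ z) × (y ∈ ws × z ∈ ws × y ≢ z)) ⊎ z ∈ x ∷ y ∷ []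
      split _ _ _ (yes refl) _ = inj₂ (here refl)
      split _ _ _ (no _) (yes refl) = inj₂ (there (here refl))
      split x∈ y∈ z∈ (no x≢z) (no y≢z) = inj₁ ((x∈ , z∈ , x≢z) , (y∈ , z∈ , y≢z))

    lowerBound : k + 3 ≤ n → n * (k + 2) ≤ 2 * ∣E∣ (graph T)
    lowerBound k+3≤n = handshake-≥ (E (graph T)) (≤∣p∣⇒AtLeast ∘ k+2≤degree k+3≤n)

  -- Existence of the minimum

  least : {P : ℕ → Set} → Decidable P → ∀ m → P m → ∃[ j ] P j × (∀ i → P i → j ≤ i)
  least {P} P? = <-rec _ λ m rec Pm → step m rec Pm (anyUpTo? P? m)
    where
    Least : Set
    Least = ∃[ j ] P j × (∀ i → P i → j ≤ i)
    step : ∀ m → (∀ {i} → i < m → P i → Least) → P m → Dec (∃[ i ] i < m × P i) → Least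
    step m rec Pm (yes (i , i<m , Pi)) = rec i<m Pi
    step m rec Pm (no none) = m , Pm , λ i Pi → ℕ.≮⇒≥ λ i<m → none (i , i<m , Pi)

  -- Every subset is a valid code, since the relation is symmetrised and its diagonal dropped. A
  -- search through all subsets therefore covers all edge sets.
  decode : Subset (n * n) → EdgeSet n
  decode S = toEdgeSet record
    { Adj = λ u v → u ≢ v × (combine u v ∈ₛ S ⊎ combine v u ∈ₛ S)
    ; adj? = λ u v → ¬? (u Finₚ.≟ v) ×-dec ((combine u v ∈ₛ? S) ⊎-dec (combine v u ∈ₛ? S))
    ; adj-sym = λ { (u≢v , inj₁ uv) → u≢v ∘ sym , inj₂ uv ; (u≢v , inj₂ vu) → u≢v ∘ sym , inj₁ vu }
    ; adj-irrefl = λ (u≢u , _) → u≢u refl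
    }

  module _ (L : EdgeSet n) where
    private
      pair? : Decidable (λ (p : Fin (n * n)) → proj₂ (remQuot {n} n p) ∈ₛ nbr L (proj₁ (remQuot {n} n p)))
      pair? p = proj₂ (remQuot {n} n p) ∈ₛ? nbr L (proj₁ (remQuot {n} n p))

    encode : Subset (n * n)
    encode = tabulate (does ∘ pair?)

    private
      encode⁺ : ∀ {u v} → v ∈ₛ nbr L u → combine u v ∈ₛ encode
      encode⁺ {u} {v} uv = ∈-tabulate-does⁺ pair?
        (subst (λ (u , v) → v ∈ₛ nbr L u) (sym (remQuot-combine u v)) uv)

      encode⁻ : ∀ {u v} → combine u v ∈ₛ encode → v ∈ₛ nbr L u
      encode⁻ {u} {v} uv = subst (λ (u , v) → v ∈ₛ nbr L u) (remQuot-combine u v) (∈-tabulate-does⁻ pair? uv)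

    decode-encode : ∀ u → nbr (decode encode) u ≡ nbr L u
    decode-encode u = ⊆-antisym (to ∘ ∈-tabulate-does⁻ dec) (∈-tabulate-does⁺ dec ∘ from)
      where
      dec : Decidable (λ v → u ≢ v × (combine u v ∈ₛ encode ⊎ combine v u ∈ₛ encode))
      dec v = ¬? (u Finₚ.≟ v) ×-dec ((combine u v ∈ₛ? encode) ⊎-dec (combine v u ∈ₛ? encode))
      to : ∀ {v} → u ≢ v × (combine u v ∈ₛ encode ⊎ combine v u ∈ₛ encode) → v ∈ₛ nbr L u
      to (_ , inj₁ uv) = encode⁻ uv
      to (_ , inj₂ vu) = EdgeSet.sym L (encode⁻ vu)
      from : ∀ {v} → v ∈ₛ nbr L u → u ≢ v × (combine u v ∈ₛ encode ⊎ combine v u ∈ₛ encode)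
      from uv = (λ { refl → irrefl L uv }) , inj₁ (encode⁺ uv)

  -- Edge sets contain functions and proofs, so decoding a code is compared with the original only
  -- through neighbourhoods.
  _≈ₑ_ : EdgeSet n → EdgeSet n → Set
  L ≈ₑ L′ = ∀ u → nbr L u ≡ nbr L′ u

  length-edges-cong : {L L′ : EdgeSet n} → L ≈ₑ L′ → length (edges L) ≡ length (edges L′)
  length-edges-cong {n} {L} {L′} L≈L′ = cong length (filter-≐ _ _
    ((λ {(u , v)} (u<v , uv) → u<v , subst (v ∈ₛ_) (L≈L′ u) uv) ,
     (λ {(u , v)} (u<v , uv) → u<v , subst (v ∈ₛ_) (sym (L≈L′ u)) uv))
    (cartesianProduct (allFin n) (allFin n)))

  Triangular : ℕ → EdgeSet n → Set
  Triangular k L = ∀ u v → v ∈ₛ nbr L u → k ≤ ∣ nbr L u ∩ nbr L v ∣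

  Triangular-cong : {L L′ : EdgeSet n} → L ≈ₑ L′ → Triangular k L → Triangular k L′
  Triangular-cong {k = k} L≈L′ tri u v uv = subst₂ (λ p q → k ≤ ∣ p ∩ q ∣) (L≈L′ u) (L≈L′ v)
    (tri u v (subst (v ∈ₛ_) (sym (L≈L′ u)) uv))

  triangular? : ∀ k (L : EdgeSet n) → Dec (Triangular k L)
  triangular? k L = all? λ u → all? λ v → (v ∈ₛ? nbr L u) →-dec (k ≤? _)

  ProperTruss : ℕ → EdgeSet n → EdgeSet n → Set
  ProperTruss k L L′ = Nonemptyₑ L × L ⊊ₑ L′ × Triangular k L

  properTruss? : ∀ k (L L′ : EdgeSet n) → Dec (ProperTruss k L L′)
  properTruss? k L L′ =
    (any? λ u → any? λ v → v ∈ₛ? nbr L u)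
    ×-dec (map′ (λ sub {u} {v} → sub u v) (λ sub u v → sub {u} {v})
            (all? λ u → all? λ v → (v ∈ₛ? nbr L u) →-dec (v ∈ₛ? nbr L′ u))
           ×-dec (any? λ u → any? λ v → (v ∈ₛ? nbr L′ u) ×-dec ¬? (v ∈ₛ? nbr L u)))
    ×-dec triangular? k L

  -- Criticality with the competing edge sets ranging over codes, which makes it decidable; the
  -- least attained size can then be found by a bounded search below the size of one given truss.
  CriticalEdgeSet : ℕ → EdgeSet n → Set
  CriticalEdgeSet k L =
    (∀ u → Nonempty (nbr L u)) × Triangular k L × ¬ (∃[ S ] ProperTruss k (decode S) L)

  criticalEdgeSet? : ∀ k (L : EdgeSet n) → Dec (CriticalEdgeSet k L)
  criticalEdgeSet? k L =
    (all? λ u → nonempty? (nbr L u)) ×-dec triangular? k L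
    ×-dec ¬? (anySubset? λ S → properTruss? k (decode S) L)

  CriticalEdgeSet⇒criticalTruss : {L : EdgeSet n} → CriticalEdgeSet k L → CriticalTrussOn n k
  CriticalEdgeSet⇒criticalTruss {n} {k} {L} (nonIsolated , tri , minimal) = record
    { graph = fullGraph L
    ; order = ∣⊤∣≡n n
    ; critical = record
      { isTruss = record { noIsolated = λ {u} _ → nonIsolated u ; triangles = tri _ _ }
      ; minimal = λ L′ (u , v , uv) (L′⊆L , u′ , v′ , u′v′ , u′v′∉) truss →
          let eq = decode-encode L′
          in minimal (encode L′ ,
            (u , v , subst (v ∈ₛ_) (sym (eq u)) uv) ,
            ((λ {u} uv → L′⊆L (subst (_ ∈ₛ_) (eq u) uv)) , u′ , v′ , u′v′ , u′v′∉ ∘ subst (v′ ∈ₛ_) (eq u′)) ,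
            Triangular-cong {L = L′} {L′ = decode (encode L′)} (sym ∘ eq) (λ u v → IsTruss.triangles truss {u} {v}))
      }
    }

  criticalTruss⇒CriticalEdgeSet : (T : CriticalTrussOn n k) → CriticalEdgeSet k (decode (encode (E (graph T))))
  criticalTruss⇒CriticalEdgeSet {n} {k} T =
    (λ u → subst Nonempty (sym (eq u)) (neighbour T u)) ,
    Triangular-cong {L = L} {L′ = decode (encode L)} (sym ∘ eq) (λ u v → triangles) ,
    λ (S , nonempty , (S⊆ , u , v , uv , uv∉) , tri) → minimal (decode S) nonempty
      ((λ {u} uv → subst (_ ∈ₛ_) (eq u) (S⊆ {u} uv)) , u , v , subst (v ∈ₛ_) (eq u) uv , uv∉)
      (Dense⇒IsTruss (decode S) (triangles⇒Dense (decode S) (tri _ _)))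
    where
    open IsCriticalTruss (critical T)
    open IsTruss isTruss
    L = E (graph T)
    eq = decode-encode L

  minimumExists : (T : CriticalTrussOn n k) → ∃[ m ] IsM* n k (fin m)
  minimumExists {n} {k} T₀ =
    let m , (S , critical , size) , minimal = least attained? _ (attained T₀)
    in m , (CriticalEdgeSet⇒criticalTruss {L = decode S} critical , size) , λ T → minimal _ (attained T)
    where
    Attained : ℕ → Set
    Attained m = ∃[ S ] CriticalEdgeSet k (decode {n} S) × length (edges (decode {n} S)) ≡ m
    attained? : Decidable Attained
    attained? m = anySubset? λ S → criticalEdgeSet? k (decode {n} S) ×-dec (length (edges (decode {n} S)) ℕ.≟ m)
    attained : (T : CriticalTrussOn n k) → Attained (∣E∣ (graph T))
    attained T = encode (E (graph T)) , criticalTruss⇒CriticalEdgeSet T ,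
      length-edges-cong {L = decode (encode (E (graph T)))} {L′ = E (graph T)} (decode-encode (E (graph T)))

  -- Cycles

  next : Fin (suc m) → Fin (suc m)
  next i with view i
  ... | ‵fromℕ = zero
  ... | ‵inject₁ j = suc j

  prev : Fin (suc m) → Fin (suc m)
  prev zero = fromℕ _
  prev (suc i) = inject₁ i

  next-fromℕ : ∀ m → next (fromℕ m) ≡ zero
  next-fromℕ m rewrite view-fromℕ m = refl

  next-inject₁ : (i : Fin m) → next (inject₁ i) ≡ suc i
  next-inject₁ i rewrite view-inject₁ i = refl

  next-prev : (i : Fin (suc m)) → next (prev i) ≡ i
  next-prev {m} zero = next-fromℕ m
  next-prev (suc i) = next-inject₁ i

  prev-next : (i : Fin (suc m)) → prev (next i) ≡ i
  prev-next i with view i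
  ... | ‵fromℕ = refl
  ... | ‵inject₁ j = refl

  next-injective : {i j : Fin (suc m)} → next i ≡ next j → i ≡ j
  next-injective eq = trans (sym (prev-next _)) (trans (cong prev eq) (prev-next _))

  -- Climb from `i` to the last index, wrap round to `zero`, and climb again to `j`.
  next-induction : (P : Fin (suc m) → Set) → (∀ i → P i → P (next i)) → ∀ i → P i → ∀ j → P j
  next-induction {m} P step i Pi j =
    <-weakInduction-startingFrom P P-zero climb {j} z≤n
    where
    climb : ∀ i → P (inject₁ i) → P (suc i)
    climb i p = subst P (next-inject₁ i) (step _ p)
    P-zero : P zero
    P-zero = subst P (next-fromℕ m) (step _ (<-weakInduction-startingFrom P Pi climb (Finₚ.≤fromℕ i)))

  toℕ-next : (i : Fin (suc m)) → ∃[ q ] toℕ (next i) + q * suc m ≡ suc (toℕ i)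
  toℕ-next {m} i with view i
  ... | ‵fromℕ = 1 , cong suc (trans (ℕ.+-identityʳ m) (sym (toℕ-fromℕ m)))
  ... | ‵inject₁ j = 0 , cong suc (trans (ℕ.+-identityʳ _) (sym (toℕ-inject₁ j)))

  private
    -- Advancing by d steps changes the index by d minus q full turns. Returning to the start would
    -- make d a multiple of m + 1, impossible for 1 ≤ d ≤ m.
    no-wrap : ∀ {m d x} q → 1 ≤ d → d ≤ m → x + q * suc m ≢ d + x
    no-wrap {d = d} {x} zero 1≤d d≤m eq =
      ℕ.m≢1+n+m x {n = pred d} (trans (sym (ℕ.+-identityʳ x)) (trans eq (cong (_+ x) (sym (ℕ.suc-pred d {{>-nonZero 1≤d}})))))
    no-wrap {m} {d} {x} (suc q) 1≤d d≤m eq = ℕ.<-irrefl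
      (sym (ℕ.+-cancelˡ-≡ x _ _ (trans eq (ℕ.+-comm d x))))
      (≤-trans (s≤s d≤m) (ℕ.m≤m+n (suc m) (q * suc m)))

  next≢ : 1 ≤ m → (i : Fin (suc m)) → next i ≢ i
  next≢ 1≤m i eq with q , e ← toℕ-next i =
    no-wrap q ≤-refl 1≤m (trans (cong (λ j → toℕ j + _) (sym eq)) e)

  next²≢ : 2 ≤ m → (i : Fin (suc m)) → next (next i) ≢ i
  next²≢ {m} 2≤m i eq with q , e ← toℕ-next i | q′ , e′ ← toℕ-next (next i) =
    no-wrap {d = 2} (q′ + q) (s≤s z≤n) 2≤m
      (trans (cong (λ j → toℕ j + (q′ + q) * suc m) (sym eq)) (trans (regroup _ q′ q m) (trans (cong (_+ q * suc m) e′) (cong suc e))))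
    where
    regroup : ∀ x q′ q m → x + (q′ + q) * suc m ≡ x + q′ * suc m + q * suc m
    regroup = solve-∀

  next³≢ : 3 ≤ m → (i : Fin (suc m)) → next (next (next i)) ≢ i
  next³≢ {m} 3≤m i eq with q , e ← toℕ-next i | q′ , e′ ← toℕ-next (next i) | q″ , e″ ← toℕ-next (next (next i)) =
    no-wrap {d = 3} (q″ + q′ + q) (s≤s z≤n) 3≤m
      (trans (cong (λ j → toℕ j + (q″ + q′ + q) * suc m) (sym eq)) (trans (regroup _ q″ q′ q m)
        (trans (cong (λ x → x + q′ * suc m + q * suc m) e″) (cong suc (trans (cong (_+ q * suc m) e′) (cong suc e))))))
    where
    regroup : ∀ x q″ q′ q m → x + (q″ + q′ + q) * suc m ≡ x + q″ * suc m + q′ * suc m + q * suc m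
    regroup = solve-∀

  CycleAdj : Fin (suc m) → Fin (suc m) → Set
  CycleAdj i j = j ≡ next i ⊎ i ≡ next j

  cycleAdj? : (i j : Fin (suc m)) → Dec (CycleAdj i j)
  cycleAdj? i j = (j Finₚ.≟ next i) ⊎-dec (i Finₚ.≟ next j)

  cycleAdj-sym : {i j : Fin (suc m)} → CycleAdj i j → CycleAdj j i
  cycleAdj-sym (inj₁ e) = inj₂ e
  cycleAdj-sym (inj₂ e) = inj₁ e

  cycleAdj-irrefl : 1 ≤ m → {i : Fin (suc m)} → ¬ CycleAdj i i
  cycleAdj-irrefl 1≤m (inj₁ e) = next≢ 1≤m _ (sym e)
  cycleAdj-irrefl 1≤m (inj₂ e) = next≢ 1≤m _ (sym e)

  -- Length at least 4 keeps cycle vertices out of the triangles on a cycle edge, so that in both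
  -- constructions such an edge has exactly k candidates.
  triangle-free : 3 ≤ m → {i j : Fin (suc m)} → CycleAdj i j → ¬ CycleAdj (next i) j
  triangle-free 3≤m {i} (inj₁ refl) = cycleAdj-irrefl (≤-trans (s≤s z≤n) 3≤m)
  triangle-free 3≤m (inj₂ refl) (inj₁ e) = next³≢ 3≤m _ (sym e)
  triangle-free 3≤m {i} (inj₂ refl) (inj₂ e) = next≢ (≤-trans (s≤s z≤n) 3≤m) _ (next-injective e)

module _ where
  open import Data.Nat using (_+_; _*_; _≤_; _<_; _≤?_; _<?_)

  open Adjacency

  -- Few vertices: a cycle joined with an almost complete graph

  mate : ∀ {k} → Fin k → Fin k
  mate {1} zero = zero
  mate {suc (suc k)} zero = suc zero
  mate {suc (suc k)} (suc zero) = zero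
  mate {suc (suc k)} (suc (suc i)) = suc (suc (mate i))

  mate-involutive : ∀ {k} (i : Fin k) → mate (mate i) ≡ i
  mate-involutive {1} zero = refl
  mate-involutive {suc (suc k)} zero = refl
  mate-involutive {suc (suc k)} (suc zero) = refl
  mate-involutive {suc (suc k)} (suc (suc i)) = cong (λ i → Fin.suc (Fin.suc i)) (mate-involutive i)

  mate-fixed-unique : ∀ {k} (i j : Fin k) → mate i ≡ i → mate j ≡ j → i ≡ j
  mate-fixed-unique {1} zero zero _ _ = refl
  mate-fixed-unique {suc (suc k)} zero j ()
  mate-fixed-unique {suc (suc k)} (suc zero) j ()
  mate-fixed-unique {suc (suc k)} (suc (suc i)) zero _ ()
  mate-fixed-unique {suc (suc k)} (suc (suc i)) (suc zero) _ ()
  mate-fixed-unique {suc (suc k)} (suc (suc i)) (suc (suc j)) ei ej =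
    cong (λ i → Fin.suc (Fin.suc i)) (mate-fixed-unique i j (inj ei) (inj ej))
    where
    inj : ∀ {n} {i j : Fin n} → Fin.suc (Fin.suc i) ≡ suc (suc j) → i ≡ j
    inj = Finₚ.suc-injective ∘ Finₚ.suc-injective

  -- The join of a cycle of length m + 1 ≥ 4 with the complete graph on k
  -- vertices ("hubs") minus a maximum matching: the missing edges are the pairs
  -- {h , mate h}, and for odd k the last hub is its own mate.
  module Join (κ m : ℕ) (3≤m : 3 ≤ m) where
    private
      k : ℕ
      k = 2 + κ

      1≤m : 1 ≤ m
      1≤m = ≤-trans (s≤s z≤n) 3≤m

    Vertex : Set
    Vertex = Fin k ⊎ Fin (suc m)

    pattern hub h = inj₁ h
    pattern cyc c = inj₂ c

    _≟_ : (a b : Vertex) → Dec (a ≡ b)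
    _≟_ = ⊎-≡-dec Finₚ._≟_ Finₚ._≟_

    JoinAdj : Vertex → Vertex → Set
    JoinAdj (hub g) (hub h) = h ≢ g × h ≢ mate g
    JoinAdj (hub g) (cyc d) = Unit
    JoinAdj (cyc c) (hub h) = Unit
    JoinAdj (cyc c) (cyc d) = CycleAdj c d

    joinAdj? : ∀ a b → Dec (JoinAdj a b)
    joinAdj? (hub g) (hub h) = ¬? (h Finₚ.≟ g) ×-dec ¬? (h Finₚ.≟ mate g)
    joinAdj? (hub g) (cyc d) = yes tt
    joinAdj? (cyc c) (hub h) = yes tt
    joinAdj? (cyc c) (cyc d) = cycleAdj? c d

    joinAdj-sym : ∀ a b → JoinAdj a b → JoinAdj b a
    joinAdj-sym (hub g) (hub h) (h≢g , h≢g′) =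
      h≢g ∘ sym , λ e → h≢g′ (trans (sym (mate-involutive h)) (cong mate (sym e)))
    joinAdj-sym (hub g) (cyc d) _ = tt
    joinAdj-sym (cyc c) (hub h) _ = tt
    joinAdj-sym (cyc c) (cyc d) = cycleAdj-sym

    joinAdj-irrefl : ∀ a → ¬ JoinAdj a a
    joinAdj-irrefl (hub h) (h≢h , _) = h≢h refl
    joinAdj-irrefl (cyc c) = cycleAdj-irrefl 1≤m

    joinGraph : Adjacency Vertex
    joinGraph = record
      { Adj = JoinAdj ; adj? = joinAdj?
      ; adj-sym = λ {a} {b} → joinAdj-sym a b ; adj-irrefl = λ {a} → joinAdj-irrefl a }

    hubs : List Vertex
    hubs = map inj₁ (allFin k)

    length-hubs : length hubs ≡ k
    length-hubs = trans (length-map inj₁ (allFin k)) (length-allFin k)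

    hubs-Unique : Unique hubs
    hubs-Unique = Uniqueₚ.map⁺ inj₁-injective (Uniqueₚ.allFin⁺ k)

    hub∈hubs : ∀ h → hub h ∈ hubs
    hub∈hubs h = ∈-map⁺ inj₁ (∈-allFin h)

    cyc∉hubs : ∀ {c} → cyc c ∉ hubs
    cyc∉hubs c∈ with _ , _ , () ← ∈-map⁻ inj₁ c∈

    hubLink : Fin (suc m) → List Vertex
    hubLink c = cyc (next c) ∷ cyc (prev c) ∷ hubs

    cyc∈hubLink : ∀ {c d} → CycleAdj c d → cyc d ∈ hubLink c
    cyc∈hubLink (inj₁ refl) = here refl
    cyc∈hubLink {d = d} (inj₂ refl) = there (here (cong cyc (sym (prev-next d))))

    hubLink-Unique : ∀ c → Unique (hubLink c)
    hubLink-Unique c =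
      ((λ e → next²≢ (≤-trans (s≤s (s≤s z≤n)) 3≤m) (prev c)
          (trans (cong next (next-prev c)) (inj₂-injective e))) ∷ ∉⇒All≢ cyc∉hubs)
      ∷ ∉⇒All≢ cyc∉hubs ∷ hubs-Unique

    nonNeighbours : Fin k → List Vertex
    nonNeighbours h = hub h ∷ hub (mate h) ∷ []

    split-hub : ∀ h g → JoinAdj (hub h) (hub g) ⊎ hub g ∈ nonNeighbours h
    split-hub h g with g Finₚ.≟ h | g Finₚ.≟ mate h
    ... | yes refl | _ = inj₂ (here refl)
    ... | no _ | yes refl = inj₂ (there (here refl))
    ... | no g≢h | no g≢h′ = inj₁ (g≢h , g≢h′)

    vertices : List Vertex
    vertices = hubs ++ map inj₂ (allFin (suc m))

    vertices-Unique : Unique vertices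
    vertices-Unique = Uniqueₚ.++⁺ hubs-Unique (Uniqueₚ.map⁺ inj₂-injective (Uniqueₚ.allFin⁺ (suc m))) disjoint
      where
      disjoint : ∀ {a} → ¬ (a ∈ hubs × a ∈ map inj₂ (allFin (suc m)))
      disjoint (a∈ , a∈′) with _ , _ , refl ← ∈-map⁻ inj₂ a∈′ = cyc∉hubs a∈

    length-vertices : length vertices ≡ k + suc m
    length-vertices = trans (length-++ hubs) (cong₂ _+_ length-hubs
      (trans (length-map inj₂ (allFin (suc m))) (length-allFin (suc m))))

    hub-cyc-dense : ∀ h c → AtLeast k (Common joinGraph (hub h) (cyc c))
    hub-cyc-dense h c = AtLeast-intro {zs = nonNeighbours h} (common? joinGraph (hub h) (cyc c)) (hubLink-Unique c) split
      (ℕ.≤-reflexive (trans (ℕ.+-comm k 2) (cong (2 +_) (sym length-hubs))))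
      where
      split : ∀ {a} → a ∈ hubLink c → Common joinGraph (hub h) (cyc c) a ⊎ a ∈ nonNeighbours h
      split (here refl) = inj₁ (tt , inj₁ refl)
      split (there (here refl)) = inj₁ (tt , inj₂ (sym (next-prev c)))
      split (there (there a∈)) with g , _ , refl ← ∈-map⁻ inj₁ a∈ with split-hub h g
      ... | inj₁ hg = inj₁ (hg , tt)
      ... | inj₂ g∈ = inj₂ g∈

    dense : Dense joinGraph k
    -- Two hubs exclude at most four hubs, themselves and their mates, and the cycle has at least
    -- four vertices to compensate. This is where n ≥ k + 4 enters.
    dense {hub g} {hub h} _ = AtLeast-intro {zs = nonNeighbours g ++ nonNeighbours h}
      (common? joinGraph (hub g) (hub h)) vertices-Unique (λ {a} _ → split a)
      (≤-trans (ℕ.+-monoʳ-≤ k (s≤s 3≤m)) (ℕ.≤-reflexive (sym length-vertices)))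
      where
      split : ∀ a → Common joinGraph (hub g) (hub h) a ⊎ a ∈ nonNeighbours g ++ nonNeighbours h
      split (cyc c) = inj₁ (tt , tt)
      split (hub f) with split-hub g f | split-hub h f
      ... | inj₁ gf | inj₁ hf = inj₁ (gf , hf)
      ... | inj₂ f∈ | _ = inj₂ (∈-++⁺ˡ f∈)
      ... | inj₁ _ | inj₂ f∈ = inj₂ (∈-++⁺ʳ (nonNeighbours g) f∈)
    dense {hub h} {cyc c} _ = hub-cyc-dense h c
    dense {cyc c} {hub h} _ = AtLeast-⊆ swap (hub-cyc-dense h c)
    dense {cyc c} {cyc d} _ = hubs , hubs-Unique , Allₚ.map⁺ (All.tabulate λ _ → tt , tt) ,
      ℕ.≤-reflexive (sym length-hubs)

    module _ (R : Adjacency Vertex) (R⊆ : ∀ {a b} → Adj R a b → JoinAdj a b) (R-dense : Dense R k) where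
      private
        OnCycle : Fin (suc m) → Set
        OnCycle c = Adj R (cyc c) (cyc (next c))

      cycleEdge-from : ∀ {c d} → Adj R (cyc c) (cyc d) → ∃ OnCycle
      cycleEdge-from {c} {d} cd with R⊆ cd
      ... | inj₁ refl = c , cd
      ... | inj₂ refl = d , adj-sym R cd

      -- Only k - 1 hubs differ from `h`, so one of the k common neighbours lies on the cycle. One
      -- application leads from a hub-cycle edge to a cycle edge, two from an edge between hubs.
      hub-escape : ∀ {h b} → Adj R (hub h) b → ∃[ c ] Adj R (hub h) (cyc c) × Adj R b (cyc c)
      hub-escape {h} {b} hb with AtLeast-escape {ys = hubs} {zs = hub h ∷ []} _≟_ (R-dense hb) ([] ∷ [])
             (λ { (here refl) → adj-irrefl R ∘ proj₁ , hub∈hubs h })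
             (ℕ.≤-reflexive (trans (cong suc length-hubs) (ℕ.+-comm 1 k)))
      ... | hub g , _ , g∉ = contradiction (hub∈hubs g) g∉
      ... | cyc c , hbc , _ = c , hbc

      cycleEdge : ∀ {a b} → Adj R a b → ∃ OnCycle
      cycleEdge {cyc c} {cyc d} cd = cycleEdge-from cd
      cycleEdge {hub h} {cyc c} hc = cycleEdge-from (proj₂ (proj₂ (hub-escape hc)))
      cycleEdge {cyc c} {hub h} ch = cycleEdge-from (proj₂ (proj₂ (hub-escape (adj-sym R ch))))
      cycleEdge {hub g} {hub h} gh =
        cycleEdge-from (proj₂ (proj₂ (hub-escape (proj₁ (proj₂ (hub-escape gh))))))

      hubEdges : ∀ {c} → OnCycle c → ∀ h → Adj R (cyc c) (hub h) × Adj R (cyc (next c)) (hub h)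
      hubEdges {c} on h = AtLeast-tight {ys = hubs} {zs = []} (common? R (cyc c) (cyc (next c))) (R-dense on)
        (λ {a} → sub a) [] (λ ()) (ℕ.≤-reflexive (trans length-hubs (sym (ℕ.+-identityʳ k)))) (hub∈hubs h) λ ()
        where
        sub : ∀ a → Common R (cyc c) (cyc (next c)) a → a ∈ hubs
        sub (hub h) _ = hub∈hubs h
        sub (cyc d) (p , q) = contradiction (R⊆ q) (triangle-free 3≤m (R⊆ p))

      -- A matched hub `h` and a cycle vertex share two cycle vertices and k - 2 hubs, exactly k
      -- candidates. A hub that is its own mate would have k + 1, hence the hypothesis on `mate h`.
      link : ∀ {h c} → mate h ≢ h → Adj R (cyc c) (hub h) → ∀ {a} → a ∈ hubLink c →
             a ∉ nonNeighbours h → Common R (hub h) (cyc c) a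
      link {h} {c} unfixed ch = AtLeast-tight (common? R (hub h) (cyc c)) (R-dense (adj-sym R ch))
        (λ {a} → sub a) (((λ e → unfixed (sym (inj₁-injective e))) ∷ []) ∷ [] ∷ [])
        (λ { (here refl) → adj-irrefl R ∘ proj₁ , there (there (hub∈hubs h))
           ; (there (here refl)) → (λ (p , _) → proj₂ (R⊆ p) refl) , there (there (hub∈hubs (mate h))) })
        (ℕ.≤-reflexive (trans (cong (2 +_) length-hubs) (ℕ.+-comm 2 k)))
        where
        sub : ∀ a → Common R (hub h) (cyc c) a → a ∈ hubLink c
        sub (hub g) _ = there (there (hub∈hubs g))
        sub (cyc d) (_ , q) = cyc∈hubLink (R⊆ q)

      cycleStep : ∀ c → OnCycle c → OnCycle (next c)
      -- Hub `zero` is matched because k ≥ 2, so its edge to `next c` is tight and forces the cycle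
      -- edge ahead.
      cycleStep c on = proj₂ (link {zero} (λ ()) (proj₂ (hubEdges on zero)) (here refl)
        λ { (here ()) ; (there (here ())) })

      cycleEdges : ∀ {a b} → Adj R a b → ∀ c → OnCycle c
      cycleEdges ab = let i , on = cycleEdge ab in next-induction OnCycle cycleStep i on

      hubEdge : (∀ c → OnCycle c) → ∀ g h → mate g ≢ g → JoinAdj (hub g) (hub h) → Adj R (hub g) (hub h)
      hubEdge on g h unfixed (h≢g , h≢g′) =
        proj₁ (link unfixed (proj₁ (hubEdges (on zero) g)) (there (there (hub∈hubs h)))
          λ { (here refl) → h≢g refl ; (there (here refl)) → h≢g′ refl })

      everyEdge : (∀ c → OnCycle c) → ∀ a b → JoinAdj a b → Adj R a b
      everyEdge on (cyc c) (cyc d) (inj₁ refl) = on c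
      everyEdge on (cyc c) (cyc d) (inj₂ refl) = adj-sym R (on d)
      everyEdge on (cyc c) (hub h) _ = proj₁ (hubEdges (on c) h)
      everyEdge on (hub h) (cyc c) _ = adj-sym R (proj₁ (hubEdges (on c) h))
      -- At most one hub is its own mate, so one end of an edge between hubs is matched, and the
      -- tight edges at that end force it.
      everyEdge on (hub g) (hub h) gh with mate g Finₚ.≟ g | mate h Finₚ.≟ h
      ... | no g-unfixed | _ = hubEdge on g h g-unfixed gh
      ... | yes _ | no h-unfixed = adj-sym R (hubEdge on h g h-unfixed (joinAdj-sym (hub g) (hub h) gh))
      ... | yes g-fixed | yes h-fixed = contradiction (mate-fixed-unique h g h-fixed g-fixed) (proj₁ gh)

    minimality : Critical k joinGraph
    minimality R R⊆ ab R-dense = everyEdge R R⊆ R-dense (cycleEdges R R⊆ R-dense ab) _ _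

    nonIsolated : ∀ a → ∃ (JoinAdj a)
    nonIsolated (hub h) = cyc zero , tt
    nonIsolated (cyc c) = hub zero , tt

    truss : CriticalTrussOn (k + suc m) k
    truss = criticalTruss (↔-sym +↔⊎) joinGraph nonIsolated (λ {a} {b} → dense {a} {b}) minimality

  -- Many vertices: a chain of cliques around a cycle

  -- A cycle of length m + 1 whose edges {c , next c} are grouped into arcs, each
  -- at least two edges long; arc c is the arc of {c , next c}. Two non-adjacent
  -- hubs see every vertex, and each arc j carries a clique of κ local vertices
  -- joined to the vertices of that arc only.
  module Chain
    (κ m b : ℕ) (3≤m : 3 ≤ m) (arc : Fin (suc m) → Fin b)
    (long : ∀ c → arc c ≡ arc (next c) ⊎ arc (next c) ≡ arc (next (next c)))
    (start : ∀ j → ∃[ c ] arc c ≢ j × arc (next c) ≡ j)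
    where

    private
      k : ℕ
      k = 2 + κ

      1≤m : 1 ≤ m
      1≤m = ≤-trans (s≤s z≤n) 3≤m

      2≤m : 2 ≤ m
      2≤m = ≤-trans (s≤s (s≤s z≤n)) 3≤m

    Vertex : Set
    Vertex = Fin 2 ⊎ (Fin (suc m) ⊎ (Fin b × Fin κ))

    pattern hub h = inj₁ h
    pattern cyc c = inj₂ (inj₁ c)
    pattern loc j t = inj₂ (inj₂ (j , t))

    _≟_ : (a b : Vertex) → Dec (a ≡ b)
    _≟_ = ⊎-≡-dec Finₚ._≟_ (⊎-≡-dec Finₚ._≟_ (×-≡-dec Finₚ._≟_ Finₚ._≟_))

    -- The vertex `c` is an end of the cycle edges indexed by `c` and `prev c`; at a junction these
    -- belong to different arcs and `c` is on both.
    On : Fin (suc m) → Fin b → Set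
    On c j = arc c ≡ j ⊎ arc (prev c) ≡ j

    on? : ∀ c j → Dec (On c j)
    on? c j = (arc c Finₚ.≟ j) ⊎-dec (arc (prev c) Finₚ.≟ j)

    on-next : ∀ {c j} → arc c ≡ j → On (next c) j
    on-next {c} e = inj₂ (trans (cong arc (prev-next c)) e)

    next-on : ∀ {c j} → On (next c) j → arc (next c) ≡ j ⊎ arc c ≡ j
    next-on (inj₁ e) = inj₁ e
    next-on {c} (inj₂ e) = inj₂ (trans (cong arc (sym (prev-next c))) e)

    -- If `c` were on the arc of the edge leaving `next c`, the edge entering `c` would belong to
    -- that arc, and the edge from `c` to `next c` would be an arc of its own, against `long`.
    not-on : ∀ {c} → arc c ≢ arc (next c) → ¬ On c (arc (next c))
    not-on junction (inj₁ e) = junction e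
    not-on {c} junction (inj₂ e) with subst (λ d → arc (prev c) ≡ arc d ⊎ arc d ≡ arc (next d)) (next-prev c) (long (prev c))
    ... | inj₁ e′ = junction (trans (sym e′) e)
    ... | inj₂ e′ = junction e′

    -- If the edge from `c` were not in `j`, then `j` would begin at `next c`, out of reach of `c`.
    -- Hence the locals in triangles on a cycle edge are those of its own arc, κ in number.
    on-both : ∀ {c j} → On c j → On (next c) j → arc c ≡ j
    on-both {c} {j} on on′ with next-on on′
    ... | inj₂ e = e
    ... | inj₁ refl with arc c Finₚ.≟ arc (next c)
    ...   | yes e = e
    ...   | no junction = contradiction on (not-on junction)

    ChainAdj : Vertex → Vertex → Set
    ChainAdj (hub g) (hub h) = ⊥
    ChainAdj (hub g) (cyc d) = Unit
    ChainAdj (hub g) (loc i s) = Unit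
    ChainAdj (cyc c) (hub h) = Unit
    ChainAdj (cyc c) (cyc d) = CycleAdj c d
    ChainAdj (cyc c) (loc i s) = On c i
    ChainAdj (loc j t) (hub h) = Unit
    ChainAdj (loc j t) (cyc d) = On d j
    ChainAdj (loc j t) (loc i s) = j ≡ i × t ≢ s

    chainAdj? : ∀ a b → Dec (ChainAdj a b)
    chainAdj? (hub g) (hub h) = no λ ()
    chainAdj? (hub g) (cyc d) = yes tt
    chainAdj? (hub g) (loc i s) = yes tt
    chainAdj? (cyc c) (hub h) = yes tt
    chainAdj? (cyc c) (cyc d) = cycleAdj? c d
    chainAdj? (cyc c) (loc i s) = on? c i
    chainAdj? (loc j t) (hub h) = yes tt
    chainAdj? (loc j t) (cyc d) = on? d j
    chainAdj? (loc j t) (loc i s) = (j Finₚ.≟ i) ×-dec ¬? (t Finₚ.≟ s)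

    chainAdj-sym : ∀ a b → ChainAdj a b → ChainAdj b a
    chainAdj-sym (hub g) (cyc d) _ = tt
    chainAdj-sym (hub g) (loc i s) _ = tt
    chainAdj-sym (cyc c) (hub h) _ = tt
    chainAdj-sym (cyc c) (cyc d) = cycleAdj-sym
    chainAdj-sym (cyc c) (loc i s) on = on
    chainAdj-sym (loc j t) (hub h) _ = tt
    chainAdj-sym (loc j t) (cyc d) on = on
    chainAdj-sym (loc j t) (loc i s) (e , t≢s) = sym e , t≢s ∘ sym

    chainAdj-irrefl : ∀ a → ¬ ChainAdj a a
    chainAdj-irrefl (cyc c) = cycleAdj-irrefl 1≤m
    chainAdj-irrefl (loc j t) (_ , t≢t) = t≢t refl

    chainGraph : Adjacency Vertex
    chainGraph = record
      { Adj = ChainAdj ; adj? = chainAdj?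
      ; adj-sym = λ {a} {b} → chainAdj-sym a b ; adj-irrefl = λ {a} → chainAdj-irrefl a }

    locals : Fin b → List Vertex
    locals j = map (λ t → loc j t) (allFin κ)

    -- In the density proofs, a `fan` supplies the third vertices for edges at a hub, hubs being
    -- non-adjacent, and a `frame` those for all other edges.
    fan : List (Fin (suc m)) → Fin b → List Vertex
    fan cs j = map (λ c → cyc c) cs ++ locals j

    frame : List (Fin (suc m)) → Fin b → List Vertex
    frame cs j = hub zero ∷ hub (suc zero) ∷ fan cs j

    cyc∈fan : ∀ {c cs j} → c ∈ cs → cyc c ∈ fan cs j
    cyc∈fan c∈ = ∈-++⁺ˡ (∈-map⁺ _ c∈)

    loc∈fan : ∀ {j t} cs → loc j t ∈ fan cs j
    loc∈fan cs = ∈-++⁺ʳ (map _ cs) (∈-map⁺ _ (∈-allFin _))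

    hub∈frame : ∀ {h cs j} → hub h ∈ frame cs j
    hub∈frame {zero} = here refl
    hub∈frame {suc zero} = there (here refl)

    fan-elim : ∀ {cs j} (P : Vertex → Set) → (∀ {c} → c ∈ cs → P (cyc c)) → (∀ t → P (loc j t)) →
               ∀ {a} → a ∈ fan cs j → P a
    fan-elim {cs} P pc pl a∈ with ∈-++⁻ (map _ cs) a∈
    ... | inj₁ a∈cs with _ , c∈ , refl ← ∈-map⁻ _ a∈cs = pc c∈
    ... | inj₂ a∈ls with t , _ , refl ← ∈-map⁻ _ a∈ls = pl t

    frame-elim : ∀ {cs j} (P : Vertex → Set) → (∀ h → P (hub h)) → (∀ {c} → c ∈ cs → P (cyc c)) → (∀ t → P (loc j t)) →
                 ∀ {a} → a ∈ frame cs j → P a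
    frame-elim P ph pc pl (here refl) = ph _
    frame-elim P ph pc pl (there (here refl)) = ph _
    frame-elim P ph pc pl (there (there a∈)) = fan-elim P pc pl a∈

    length-fan : ∀ cs j → length (fan cs j) ≡ length cs + κ
    length-fan cs j = trans (length-++ (map _ cs)) (cong₂ _+_ (length-map _ cs)
      (trans (length-map _ (allFin κ)) (length-allFin κ)))

    length-frame : ∀ cs j → length (frame cs j) ≡ 2 + (length cs + κ)
    length-frame cs j = cong (2 +_) (length-fan cs j)

    fan-Unique : ∀ {cs j} → Unique cs → Unique (fan cs j)
    fan-Unique u = Uniqueₚ.++⁺ (Uniqueₚ.map⁺ (λ { refl → refl }) u)
      (Uniqueₚ.map⁺ (λ { refl → refl }) (Uniqueₚ.allFin⁺ κ)) disjoint
      where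
      disjoint : ∀ {cs j a} → ¬ (a ∈ map (λ c → cyc c) cs × a ∈ locals j)
      disjoint (a∈ , a∈′) with _ , _ , refl ← ∈-map⁻ _ a∈ with _ , _ , () ← ∈-map⁻ _ a∈′

    frame-Unique : ∀ {cs j} → Unique cs → Unique (frame cs j)
    frame-Unique {cs} {j} u = ((λ ()) ∷ ∉⇒All≢ hub∉) ∷ ∉⇒All≢ hub∉ ∷ fan-Unique u
      where
      hub∉ : ∀ {h} → hub h ∉ fan cs j
      hub∉ {h} h∈ = fan-elim (_≢ hub h) (λ _ ()) (λ _ ()) h∈ refl

    onArc : ∀ j → ∃[ c ] On c j × On (next c) j × On (next (next c)) j
    onArc j with start j
    ... | c , c≢ , refl with long c
    ...   | inj₁ e = contradiction e c≢
    ...   | inj₂ e = next c , inj₁ refl , on-next refl , on-next (sym e)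

    cyc-next-dense : ∀ c → AtLeast k (Common chainGraph (cyc c) (cyc (next c)))
    cyc-next-dense c = frame [] (arc c) , frame-Unique [] ,
      All.tabulate (frame-elim (Common chainGraph (cyc c) (cyc (next c))) (λ _ → tt , tt) (λ ()) (λ _ → inj₁ refl , on-next refl)) ,
      ℕ.≤-reflexive (sym (length-frame [] (arc c)))

    hub-cyc-dense : ∀ h c → AtLeast k (Common chainGraph (hub h) (cyc c))
    hub-cyc-dense h c = fan (next c ∷ prev c ∷ []) (arc c) , fan-Unique ((distinct ∷ []) ∷ [] ∷ []) ,
      All.tabulate (fan-elim (Common chainGraph (hub h) (cyc c)) (λ { (here refl) → tt , inj₁ refl ; (there (here refl)) → tt , inj₂ (sym (next-prev c)) })
        (λ _ → tt , inj₁ refl)) ,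
      ℕ.≤-reflexive (sym (length-fan (next c ∷ prev c ∷ []) (arc c)))
      where
      distinct : next c ≢ prev c
      distinct e = next²≢ 2≤m (prev c) (trans (cong next (next-prev c)) e)

    CommonOr : Vertex → Vertex → List Vertex → Vertex → Set
    CommonOr a b zs c = Common chainGraph a b c ⊎ c ∈ zs

    split-local : ∀ {j t} s → ChainAdj (loc j t) (loc j s) ⊎ (_∈_ {A = Vertex} (loc j s) (loc j t ∷ []))
    split-local {j} {t} s with t Finₚ.≟ s
    ... | yes refl = inj₂ (here refl)
    ... | no t≢s = inj₁ (refl , t≢s)

    -- The κ - 1 other locals fall three short of k; three consecutive vertices of the arc fill the
    -- gap, which requires two edges in it.
    hub-loc-dense : ∀ h j t → AtLeast k (Common chainGraph (hub h) (loc j t))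
    hub-loc-dense h j t with onArc j
    ... | c , on₀ , on₁ , on₂ = AtLeast-intro {ys = fan (c ∷ next c ∷ next (next c) ∷ []) j} {zs = loc j t ∷ []}
      (common? chainGraph (hub h) (loc j t))
      (fan-Unique ((next≢ 1≤m c ∘ sym ∷ next²≢ 2≤m c ∘ sym ∷ []) ∷ (next≢ 1≤m (next c) ∘ sym ∷ []) ∷ [] ∷ []))
      (fan-elim (CommonOr (hub h) (loc j t) (loc j t ∷ []))
        (λ { (here refl) → inj₁ (tt , on₀) ; (there (here refl)) → inj₁ (tt , on₁) ; (there (there (here refl))) → inj₁ (tt , on₂) })
        locals-split)
      (ℕ.≤-reflexive (trans (ℕ.+-comm k 1) (sym (length-fan (c ∷ next c ∷ next (next c) ∷ []) j))))
      where
      locals-split : ∀ s → CommonOr (hub h) (loc j t) (loc j t ∷ []) (loc j s)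
      locals-split s with split-local {j} {t} s
      ... | inj₁ ts = inj₁ (tt , ts)
      ... | inj₂ s∈ = inj₂ s∈

    cyc-loc-dense : ∀ c j t → On c j → AtLeast k (Common chainGraph (cyc c) (loc j t))
    cyc-loc-dense c j t on = AtLeast-intro {ys = frame (d ∷ []) j} {zs = loc j t ∷ []}
      (common? chainGraph (cyc c) (loc j t)) (frame-Unique ([] ∷ []))
      (frame-elim (CommonOr (cyc c) (loc j t) (loc j t ∷ [])) (λ _ → inj₁ (tt , tt)) (λ { (here refl) → inj₁ (proj₂ (along on)) }) locals-split)
      (ℕ.≤-reflexive (trans (ℕ.+-comm k 1) (sym (length-frame (d ∷ []) j))))
      where
      along : On c j → ∃[ d ] CycleAdj c d × On d j
      along (inj₁ e) = next c , inj₁ refl , on-next e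
      along (inj₂ e) = prev c , inj₂ (sym (next-prev c)) , inj₁ e
      d = proj₁ (along on)
      locals-split : ∀ s → CommonOr (cyc c) (loc j t) (loc j t ∷ []) (loc j s)
      locals-split s with split-local {j} {t} s
      ... | inj₁ ts = inj₁ (on , ts)
      ... | inj₂ s∈ = inj₂ s∈

    loc-loc-dense : ∀ j t u → AtLeast k (Common chainGraph (loc j t) (loc j u))
    loc-loc-dense j t u with onArc j
    ... | c , on₀ , on₁ , _ = AtLeast-intro {ys = frame (c ∷ next c ∷ []) j} {zs = loc j t ∷ loc j u ∷ []}
      (common? chainGraph (loc j t) (loc j u)) (frame-Unique ((next≢ 1≤m c ∘ sym ∷ []) ∷ [] ∷ []))
      (frame-elim (CommonOr (loc j t) (loc j u) (loc j t ∷ loc j u ∷ [])) (λ _ → inj₁ (tt , tt))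
        (λ { (here refl) → inj₁ (on₀ , on₀) ; (there (here refl)) → inj₁ (on₁ , on₁) }) locals-split)
      (ℕ.≤-reflexive (trans (ℕ.+-comm k 2) (sym (length-frame (c ∷ next c ∷ []) j))))
      where
      locals-split : ∀ s → CommonOr (loc j t) (loc j u) (loc j t ∷ loc j u ∷ []) (loc j s)
      locals-split s with split-local {j} {t} s | split-local {j} {u} s
      ... | inj₁ ts | inj₁ us = inj₁ (ts , us)
      ... | inj₂ (here e) | _ = inj₂ (here e)
      ... | inj₁ _ | inj₂ s∈ = inj₂ (there s∈)

    dense : Dense chainGraph k
    dense {hub h} {cyc c} _ = hub-cyc-dense h c
    dense {hub h} {loc j t} _ = hub-loc-dense h j t
    dense {cyc c} {hub h} _ = AtLeast-⊆ swap (hub-cyc-dense h c)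
    dense {cyc c} {cyc d} (inj₁ refl) = cyc-next-dense c
    dense {cyc c} {cyc d} (inj₂ refl) = AtLeast-⊆ swap (cyc-next-dense d)
    dense {cyc c} {loc j t} on = cyc-loc-dense c j t on
    dense {loc j t} {hub h} _ = AtLeast-⊆ swap (hub-loc-dense h j t)
    dense {loc j t} {cyc c} on = AtLeast-⊆ swap (cyc-loc-dense c j t on)
    dense {loc j t} {loc .j u} (refl , _) = loc-loc-dense j t u

    module _ (R : Adjacency Vertex) (R⊆ : ∀ {a b} → Adj R a b → ChainAdj a b) (R-dense : Dense R k) where
      private
        OnCycle : Fin (suc m) → Set
        OnCycle c = Adj R (cyc c) (cyc (next c))

      cycleEdge-from : ∀ {c d} → Adj R (cyc c) (cyc d) → ∃ OnCycle
      cycleEdge-from {c} {d} cd with R⊆ cd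
      ... | inj₁ refl = c , cd
      ... | inj₂ refl = d , adj-sym R cd

      -- Off the cycle, a local has only the two hubs and κ - 1 locals as neighbours, k - 1 in all.
      loc-escape : ∀ {j t b} → Adj R (loc j t) b → ∃[ c ] Adj R (loc j t) (cyc c) × Adj R b (cyc c)
      loc-escape {j} {t} lb with AtLeast-escape {ys = frame [] j} {zs = loc j t ∷ []} _≟_ (R-dense lb) ([] ∷ [])
             (λ { (here refl) → adj-irrefl R ∘ proj₁ , there (there (loc∈fan [])) })
             (ℕ.≤-reflexive (trans (cong suc (length-frame [] j)) (ℕ.+-comm 1 k)))
      ... | hub h , _ , h∉ = contradiction hub∈frame h∉
      ... | cyc c , lbc , _ = c , lbc
      ... | loc i s , (ls , _) , s∉ with refl , _ ← R⊆ ls = contradiction (there (there (loc∈fan []))) s∉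

      cycleEdge-from-loc : ∀ {j t c} → Adj R (loc j t) (cyc c) → ∃ OnCycle
      cycleEdge-from-loc lc = cycleEdge-from (proj₂ (proj₂ (loc-escape lc)))

      cycleEdge-from-hub : ∀ {h c} → Adj R (hub h) (cyc c) → ∃ OnCycle
      -- With `ys` empty, `AtLeast-escape` just picks some triangle on the edge. Its third vertex is
      -- no hub, and either of the other two kinds leads to a cycle edge.
      cycleEdge-from-hub {h} {c} hc with AtLeast-escape {ys = []} {zs = []} _≟_ (R-dense hc) [] (λ ()) (s≤s z≤n)
      ... | hub g , (hg , _) , _ with () ← R⊆ hg
      ... | cyc d , (_ , cd) , _ = cycleEdge-from cd
      ... | loc j t , (_ , cl) , _ = cycleEdge-from-loc (adj-sym R cl)

      cycleEdge : ∀ {a b} → Adj R a b → ∃ OnCycle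
      cycleEdge {loc j t} lb = cycleEdge-from-loc (proj₁ (proj₂ (loc-escape lb)))
      cycleEdge {cyc c} {cyc d} cd = cycleEdge-from cd
      cycleEdge {cyc c} {hub h} ch = cycleEdge-from-hub (adj-sym R ch)
      cycleEdge {cyc c} {loc j t} cl = cycleEdge-from-loc (adj-sym R cl)
      cycleEdge {hub h} {cyc c} hc = cycleEdge-from-hub hc
      cycleEdge {hub h} {loc j t} hl = cycleEdge-from-loc (proj₁ (proj₂ (loc-escape (adj-sym R hl))))
      cycleEdge {hub g} {hub h} gh with () ← R⊆ gh

      frameEdges : ∀ {c} → OnCycle c → ∀ {a} → a ∈ frame [] (arc c) → Common R (cyc c) (cyc (next c)) a
      frameEdges {c} on a∈ = AtLeast-tight {ys = frame [] (arc c)} {zs = []} (common? R (cyc c) (cyc (next c))) (R-dense on)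
        (λ {a} → sub a) [] (λ ()) (ℕ.≤-reflexive (trans (length-frame [] (arc c)) (sym (ℕ.+-identityʳ k)))) a∈ λ ()
        where
        sub : ∀ a → Common R (cyc c) (cyc (next c)) a → a ∈ frame [] (arc c)
        sub (hub h) _ = hub∈frame
        sub (cyc d) (p , q) = contradiction (R⊆ q) (triangle-free 3≤m (R⊆ p))
        sub (loc j t) (p , q) with refl ← on-both (R⊆ p) (R⊆ q) = there (there (loc∈fan []))

      -- At the first vertex of an arc only the cycle neighbour ahead lies on the arc. With two hubs
      -- and κ - 1 other locals that makes exactly k candidates.
      startEdges : ∀ {c t} → arc c ≢ arc (next c) → Adj R (cyc (next c)) (loc (arc (next c)) t) →
                   ∀ {a} → a ∈ frame (next (next c) ∷ []) (arc (next c)) → a ∉ loc (arc (next c)) t ∷ [] →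
                   Common R (cyc (next c)) (loc (arc (next c)) t) a
      startEdges {c} {t} junction cl = AtLeast-tight (common? R (cyc (next c)) (loc (arc (next c)) t)) (R-dense cl)
        (λ {a} → sub a) ([] ∷ []) (λ { (here refl) → adj-irrefl R ∘ proj₂ , there (there (loc∈fan (next (next c) ∷ []))) })
        (ℕ.≤-reflexive (trans (length-frame (next (next c) ∷ []) (arc (next c))) (ℕ.+-comm 1 k)))
        where
        sub : ∀ a → Common R (cyc (next c)) (loc (arc (next c)) t) a → a ∈ frame (next (next c) ∷ []) (arc (next c))
        sub (hub h) _ = hub∈frame
        sub (loc j s) (_ , q) with refl , _ ← R⊆ q = there (there (loc∈fan (next (next c) ∷ [])))
        sub (cyc d) (p , q) with R⊆ p
        ... | inj₁ refl = there (there (cyc∈fan (here refl)))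
        ... | inj₂ e with refl ← next-injective e = contradiction (R⊆ q) (not-on junction)

      -- Inside an arc, the edge from a hub to `next c` has the two cycle neighbours and κ locals as
      -- its k candidates, so the cycle edge ahead is forced. At a junction, `c` and the old locals
      -- are only k - 1, so another common neighbour exists: either the next cycle vertex itself, or
      -- a local of the new arc, whose edge to `next c` is tight by `startEdges`.
      cycleStep : ∀ c → OnCycle c → OnCycle (next c)
      cycleStep c on with proj₂ (frameEdges on (here refl)) | arc c Finₚ.≟ arc (next c)
      ... | ch | yes interior = proj₂ (AtLeast-tight {ys = fan cs (arc (next c))} {zs = []} (common? R (hub zero) (cyc (next c)))
          (R-dense (adj-sym R ch)) (λ {a} → sub a) [] (λ ())
          (ℕ.≤-reflexive (trans (length-fan cs (arc (next c))) (sym (ℕ.+-identityʳ k)))) (cyc∈fan (here refl)) λ ())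
        where
        cs = next (next c) ∷ c ∷ []
        sub : ∀ a → Common R (hub zero) (cyc (next c)) a → a ∈ fan cs (arc (next c))
        sub (hub h) (p , _) with () ← R⊆ p
        sub (cyc d) (_ , q) with R⊆ q
        ... | inj₁ refl = cyc∈fan (here refl)
        ... | inj₂ e = cyc∈fan (there (here (sym (next-injective e))))
        sub (loc j t) (_ , q) with next-on (R⊆ q)
        ... | inj₁ refl = loc∈fan cs
        ... | inj₂ refl = subst (λ j → loc (arc c) t ∈ fan cs j) interior (loc∈fan cs)
      ... | ch | no junction with AtLeast-escape {ys = fan (c ∷ []) (arc c)} {zs = []} _≟_ (R-dense (adj-sym R ch)) [] (λ ())
            (ℕ.≤-reflexive (trans (cong suc (length-fan (c ∷ []) (arc c))) (sym (ℕ.+-identityʳ k))))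
      ...   | hub h , (p , _) , _ with () ← R⊆ p
      cycleStep c on | ch | no junction | cyc d , (_ , q) , d∉ with R⊆ q
      ... | inj₁ refl = q
      ... | inj₂ e with refl ← next-injective e = contradiction (cyc∈fan (here refl)) d∉
      cycleStep c on | ch | no junction | loc j t , (_ , q) , l∉ with next-on (R⊆ q)
      ... | inj₂ refl = contradiction (loc∈fan (c ∷ [])) l∉
      ... | inj₁ refl = proj₁ (startEdges junction q (there (there (cyc∈fan (here refl)))) λ { (here ()) })

      cycleEdges : ∀ {a b} → Adj R a b → ∀ c → OnCycle c
      cycleEdges ab = let c , on = cycleEdge ab in next-induction OnCycle cycleStep c on

      module _ (cycle : ∀ c → OnCycle c) where
        localEdges : ∀ j t {a} → a ∈ frame [] j → a ∉ loc j t ∷ [] → Adj R (loc j t) a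
        localEdges j t a∈ a∉ with start j
        -- Edges at a local are reached from the first vertex of its arc, where the edge to that
        -- local is tight.
        ... | c , c≢ , refl = proj₂ (startEdges c≢ (proj₁ (frameEdges (cycle (next c)) (there (there (loc∈fan [])))))
          (frame-elim (_∈ frame (next (next c) ∷ []) (arc (next c))) (λ _ → hub∈frame) (λ ())
            (λ _ → there (there (loc∈fan (next (next c) ∷ [])))) a∈) a∉)

        cyc-loc-edge : ∀ {c j t} → On c j → Adj R (cyc c) (loc j t)
        cyc-loc-edge {c} (inj₁ refl) = proj₁ (frameEdges (cycle c) (there (there (loc∈fan []))))
        cyc-loc-edge {c} {t = t} (inj₂ refl) = subst (λ d → Adj R (cyc d) (loc (arc (prev c)) t)) (next-prev c)
          (proj₂ (frameEdges (cycle (prev c)) (there (there (loc∈fan [])))))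

        everyEdge : ∀ a b → ChainAdj a b → Adj R a b
        everyEdge (hub h) (cyc c) _ = adj-sym R (proj₁ (frameEdges (cycle c) hub∈frame))
        everyEdge (cyc c) (hub h) _ = proj₁ (frameEdges (cycle c) hub∈frame)
        everyEdge (cyc c) (cyc d) (inj₁ refl) = cycle c
        everyEdge (cyc c) (cyc d) (inj₂ refl) = adj-sym R (cycle d)
        everyEdge (cyc c) (loc j t) on = cyc-loc-edge on
        everyEdge (loc j t) (cyc c) on = adj-sym R (cyc-loc-edge on)
        everyEdge (loc j t) (hub h) _ = localEdges j t hub∈frame λ { (here ()) }
        everyEdge (hub h) (loc j t) _ = adj-sym R (localEdges j t hub∈frame λ { (here ()) })
        everyEdge (loc j t) (loc .j s) (refl , t≢s) = localEdges j t (there (there (loc∈fan []))) λ { (here refl) → t≢s refl }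

    minimality : Critical k chainGraph
    minimality R R⊆ ab R-dense = everyEdge R R⊆ R-dense (cycleEdges R R⊆ R-dense ab) _ _

    nonIsolated : ∀ a → ∃ (ChainAdj a)
    nonIsolated (hub h) = cyc zero , tt
    nonIsolated (cyc c) = hub zero , tt
    nonIsolated (loc j t) = hub zero , tt

    size : ℕ
    size = 2 + (suc m + b * κ)

    labelling : Vertex ↔ Fin size
    labelling = ↔-sym ((↔-refl ⊎-↔ ((↔-refl ⊎-↔ *↔×) ↔-∘ +↔⊎)) ↔-∘ +↔⊎)

    truss : CriticalTrussOn size k
    truss = criticalTruss labelling chainGraph nonIsolated (λ {a} {b} → dense {a} {b}) minimality

    module _ (arcEnd : Fin b → Fin (suc m)) (arcEnd-next : ∀ c → arc c ≢ arc (next c) → next c ≡ arcEnd (arc c)) where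

      private
        slots : List (Fin b × Fin κ)
        slots = cartesianProduct (allFin b) (allFin κ)

        slot∈ : ∀ l → l ∈ slots
        slot∈ (j , t) = ∈-cartesianProduct⁺ (∈-allFin j) (∈-allFin t)

        length-slots : length slots ≡ b * κ
        length-slots = trans (length-cartesianProductWith _,_ (allFin b) (allFin κ)) (cong₂ _*_ (length-allFin b) (length-allFin κ))

        hub-cycle : Fin 2 → Fin (suc m) → Vertex × Vertex
        hub-cycle h c = hub h , cyc c

        hub-slot : Fin 2 → Fin b × Fin κ → Vertex × Vertex
        hub-slot h l = hub h , inj₂ (inj₂ l)

        -- `allDarts` covers every ordered adjacent pair. `cyc-loc` pairs a vertex with the arc of
        -- its outgoing edge; a vertex on an arc through its incoming edge alone is the end of that
        -- arc, so `end-loc` adds one vertex per arc.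
        hub-cyc hub-loc cyc-cyc cyc-loc end-loc oneWay loc-loc allDarts diagonal : List (Vertex × Vertex)
        hub-cyc = cartesianProductWith hub-cycle (allFin 2) (allFin (suc m))
        hub-loc = cartesianProductWith hub-slot (allFin 2) slots
        cyc-cyc = map (λ c → cyc c , cyc (next c)) (allFin (suc m))
        cyc-loc = cartesianProductWith (λ c t → cyc c , loc (arc c) t) (allFin (suc m)) (allFin κ)
        end-loc = map (λ (j , t) → cyc (arcEnd j) , loc j t) slots
        oneWay = hub-cyc ++ hub-loc ++ cyc-cyc ++ cyc-loc ++ end-loc
        -- Includes the b * κ diagonal pairs, which edgeCount subtracts again.
        loc-loc = cartesianProductWith (λ (j , t) s → loc j t , loc j s) slots (allFin κ)
        allDarts = (oneWay ++ map swap oneWay) ++ loc-loc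
        diagonal = map (λ l → inj₂ (inj₂ l) , inj₂ (inj₂ l)) slots

        oneWaySize : ℕ
        oneWaySize = 2 * suc m + (2 * (b * κ) + (suc m + (suc m * κ + b * κ)))

        length-oneWay : length oneWay ≡ oneWaySize
        length-oneWay =
          trans (length-++ hub-cyc) (cong₂ _+_
            (trans (length-cartesianProductWith hub-cycle (allFin 2) (allFin (suc m))) (cong (2 *_) (length-allFin (suc m))))
          (trans (length-++ hub-loc) (cong₂ _+_
            (trans (length-cartesianProductWith hub-slot (allFin 2) slots) (cong (2 *_) length-slots))
          (trans (length-++ cyc-cyc) (cong₂ _+_
            (trans (length-map _ (allFin (suc m))) (length-allFin (suc m)))
          (trans (length-++ cyc-loc) (cong₂ _+_
            (trans (length-cartesianProductWith _ (allFin (suc m)) (allFin κ)) (cong₂ _*_ (length-allFin (suc m)) (length-allFin κ)))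
            (trans (length-map _ slots) length-slots))))))))

        length-allDarts : length allDarts ≡ oneWaySize + oneWaySize + b * κ * κ
        length-allDarts = trans (length-++ (oneWay ++ map swap oneWay)) (cong₂ _+_
          (trans (length-++ oneWay) (cong₂ _+_ length-oneWay (trans (length-map swap oneWay) length-oneWay)))
          (trans (length-cartesianProductWith _ slots (allFin κ)) (cong₂ _*_ length-slots (length-allFin κ))))

        forward : ∀ {d} → d ∈ oneWay → d ∈ allDarts
        forward d∈ = ∈-++⁺ˡ (∈-++⁺ˡ d∈)

        backward : ∀ {d} → d ∈ oneWay → swap d ∈ allDarts
        backward d∈ = ∈-++⁺ˡ (∈-++⁺ʳ oneWay (∈-map⁺ swap d∈))

        hub-cyc∈ : ∀ h c → (hub h , cyc c) ∈ oneWay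
        hub-cyc∈ h c = ∈-++⁺ˡ (∈-cartesianProductWith⁺ hub-cycle (∈-allFin h) (∈-allFin c))

        hub-loc∈ : ∀ h j t → (hub h , loc j t) ∈ oneWay
        hub-loc∈ h j t = ∈-++⁺ʳ hub-cyc (∈-++⁺ˡ (∈-cartesianProductWith⁺ hub-slot (∈-allFin h) (slot∈ (j , t))))

        cyc-cyc∈ : ∀ c → (cyc c , cyc (next c)) ∈ oneWay
        cyc-cyc∈ c = ∈-++⁺ʳ hub-cyc (∈-++⁺ʳ hub-loc (∈-++⁺ˡ (∈-map⁺ _ (∈-allFin c))))

        cyc-loc∈ : ∀ c j t → On c j → (cyc c , loc j t) ∈ oneWay
        cyc-loc∈ c j t on with arc c Finₚ.≟ j | on
        ... | yes refl | _ = ∈-++⁺ʳ hub-cyc (∈-++⁺ʳ hub-loc (∈-++⁺ʳ cyc-cyc (∈-++⁺ˡ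
          (∈-cartesianProductWith⁺ _ (∈-allFin c) (∈-allFin t)))))
        ... | no c≢j | inj₁ c≡j = contradiction c≡j c≢j
        ... | no c≢j | inj₂ refl = subst (λ d → (cyc d , loc (arc (prev c)) t) ∈ oneWay) (sym c≡arcEnd)
          (∈-++⁺ʳ hub-cyc (∈-++⁺ʳ hub-loc (∈-++⁺ʳ cyc-cyc (∈-++⁺ʳ cyc-loc (∈-map⁺ _ (slot∈ (arc (prev c) , t)))))))
          where
          c≡arcEnd : c ≡ arcEnd (arc (prev c))
          c≡arcEnd = trans (sym (next-prev c)) (arcEnd-next (prev c) λ e → c≢j (trans (cong arc (sym (next-prev c))) (sym e)))

        loc-loc∈ : ∀ j t s → (loc j t , loc j s) ∈ allDarts
        loc-loc∈ j t s = ∈-++⁺ʳ (oneWay ++ map swap oneWay) (∈-cartesianProductWith⁺ _ (slot∈ (j , t)) (∈-allFin s))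

        dart∈ : ∀ a b → ChainAdj a b → (a , b) ∈ allDarts
        dart∈ (hub h) (cyc c) _ = forward (hub-cyc∈ h c)
        dart∈ (hub h) (loc j t) _ = forward (hub-loc∈ h j t)
        dart∈ (cyc c) (hub h) _ = backward (hub-cyc∈ h c)
        dart∈ (loc j t) (hub h) _ = backward (hub-loc∈ h j t)
        dart∈ (cyc c) (cyc d) (inj₁ refl) = forward (cyc-cyc∈ c)
        dart∈ (cyc c) (cyc d) (inj₂ refl) = backward (cyc-cyc∈ d)
        dart∈ (cyc c) (loc j t) on = forward (cyc-loc∈ c j t on)
        dart∈ (loc j t) (cyc c) on = backward (cyc-loc∈ c j t on)
        dart∈ (loc j t) (loc .j s) (refl , _) = loc-loc∈ j t s

      edgeCount : 2 * ∣E∣ (graph truss) + b * κ ≤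
                  2 * (2 * suc m + (2 * (b * κ) + (suc m + (suc m * κ + b * κ)))) + b * κ * κ
      edgeCount = subst₂ (λ x y → 2 * ∣E∣ (graph truss) + x ≤ y)
        (trans (length-map _ slots) length-slots)
        (trans length-allDarts (cong (_+ b * κ * κ) (cong (oneWaySize +_) (sym (ℕ.+-identityʳ _)))))
        (AtLeast-bound (manyDarts-↔ labelling chainGraph) (λ {(a , b)} → dart∈ a b)
          (Uniqueₚ.map⁺ (λ e → inj₂-injective (inj₂-injective (cong proj₁ e)))
            (Uniqueₚ.cartesianProduct⁺ (Uniqueₚ.allFin⁺ b) (Uniqueₚ.allFin⁺ κ)))
          diagonal⊆)
        where
        diagonal⊆ : ∀ {d} → d ∈ diagonal → ¬ uncurry ChainAdj d × d ∈ allDarts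
        diagonal⊆ d∈ with (j , t) , _ , refl ← ∈-map⁻ _ d∈ = (λ (_ , t≢t) → t≢t refl) , loc-loc∈ j t t

  -- Cutting the cycle into arcs

  next-cases : ∀ {m} (c : Fin (suc m)) → toℕ (next c) ≡ suc (toℕ c) ⊎ (c ≡ fromℕ m × next c ≡ zero)
  next-cases c with view c
  ... | ‵fromℕ = inj₂ (refl , refl)
  ... | ‵inject₁ d = inj₁ (cong suc (sym (toℕ-inject₁ d)))

  -- min(⌊ i / 2 ⌋ , β)
  arcAt : ∀ β → ℕ → Fin (suc β)
  arcAt zero _ = zero
  arcAt (suc β) 0 = zero
  arcAt (suc β) 1 = zero
  arcAt (suc β) (suc (suc i)) = suc (arcAt β i)

  arcAt-long : ∀ β i → arcAt β i ≡ arcAt β (suc i) ⊎ arcAt β (suc i) ≡ arcAt β (suc (suc i))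
  arcAt-long zero i = inj₁ refl
  arcAt-long (suc β) 0 = inj₁ refl
  arcAt-long (suc zero) 1 = inj₂ refl
  arcAt-long (suc (suc β)) 1 = inj₂ refl
  arcAt-long (suc β) (suc (suc i)) with arcAt-long β i
  ... | inj₁ e = inj₁ (cong suc e)
  ... | inj₂ e = inj₂ (cong suc e)

  double-suc≤ : ∀ {β i} → suc β + suc β ≤ suc (suc i) → β + β ≤ i
  double-suc≤ {β} {i} le = ℕ.≤-pred (subst (_≤ suc i) (ℕ.+-suc β β) (ℕ.≤-pred le))

  arcAt-last : ∀ β {i} → β + β ≤ i → arcAt β i ≡ fromℕ β
  arcAt-last zero _ = refl
  arcAt-last (suc β) {zero} ()
  arcAt-last (suc β) {suc zero} (s≤s le) = contradiction (subst (_≤ 0) (ℕ.+-suc β β) le) λ ()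
  arcAt-last (suc β) {suc (suc i)} le = cong suc (arcAt-last β (double-suc≤ le))

  arcAt-odd : ∀ {β} (j : Fin β) → arcAt β (suc (toℕ j + toℕ j)) ≡ inject₁ j
  arcAt-odd zero = refl
  arcAt-odd {suc β} (suc j) rewrite ℕ.+-suc (toℕ j) (toℕ j) = cong suc (arcAt-odd j)

  arcAt-even : ∀ {β} (j : Fin β) → arcAt β (suc (suc (toℕ j + toℕ j))) ≡ suc j
  arcAt-even {suc zero} zero = refl
  arcAt-even {suc (suc β)} zero = refl
  arcAt-even {suc β} (suc j) rewrite ℕ.+-suc (toℕ j) (toℕ j) = cong suc (arcAt-even j)

  arcAt-jump : ∀ β i → arcAt β i ≢ arcAt β (suc i) →
               toℕ (arcAt β i) < β × suc i ≡ suc (suc (toℕ (arcAt β i) + toℕ (arcAt β i)))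
  arcAt-jump zero i ne = contradiction refl ne
  arcAt-jump (suc β) 0 ne = contradiction refl ne
  arcAt-jump (suc β) 1 ne = s≤s z≤n , refl
  arcAt-jump (suc β) (suc (suc i)) ne with arcAt-jump β i (ne ∘ cong suc)
  ... | lt , e = s≤s lt , cong (2 +_) (trans e (cong suc (sym (ℕ.+-suc a a))))
    where a = toℕ (arcAt β i)

  module Arcs (β e : ℕ) where
    -- The cycle length m + 1 is 2(β + 2) + e: two edges for each of β + 2 arcs, and a surplus of e
    -- that goes to the last arc, where `arcAt` saturates.
    m : ℕ
    m = 3 + (β + β + e)

    private
      last≤ : suc β + suc β ≤ suc (suc (β + β + e))
      last≤ = s≤s (subst (_≤ suc (β + β + e)) (sym (ℕ.+-suc β β)) (s≤s (ℕ.m≤m+n (β + β) e)))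

      arc-last : ∀ {i} → suc (suc (β + β + e)) ≤ i → arcAt (suc β) i ≡ fromℕ (suc β)
      arc-last le = arcAt-last (suc β) (≤-trans last≤ le)

      double≤ : ∀ (j : Fin (suc β)) → toℕ j + toℕ j ≤ β + β + e
      double≤ j = ≤-trans (ℕ.+-mono-≤ (toℕ≤pred[n] j) (toℕ≤pred[n] j)) (ℕ.m≤m+n (β + β) e)

    arc : Fin (suc m) → Fin (suc (suc β))
    arc c = arcAt (suc β) (toℕ c)

    long : ∀ c → arc c ≡ arc (next c) ⊎ arc (next c) ≡ arc (next (next c))
    long c with next-cases c
    ... | inj₂ (_ , e₀) = inj₂ (subst (λ d → arc d ≡ arc (next d)) (sym e₀) refl)
    ... | inj₁ e₁ with next-cases (next c)
    ...   | inj₁ e₂ = subst₂ (λ x y → arc c ≡ arcAt (suc β) x ⊎ arcAt (suc β) x ≡ arcAt (suc β) y)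
                        (sym e₁) (sym (trans e₂ (cong suc e₁))) (arcAt-long (suc β) (toℕ c))
    -- Here `c` and `next c` are the last two positions, and the last arc has at least two edges.
    ...   | inj₂ (e₂ , _) = inj₁ (trans (arc-last (ℕ.≤-pred (ℕ.≤-reflexive m≡)))
                                  (sym (arc-last (≤-trans (ℕ.n≤1+n _) (ℕ.≤-reflexive (trans m≡ (sym e₁)))))))
      where
      m≡ : m ≡ suc (toℕ c)
      m≡ = trans (sym (toℕ-fromℕ m)) (trans (cong toℕ (sym e₂)) e₁)

    last≤m : suc (suc (β + β + e)) ≤ toℕ (fromℕ m)
    last≤m = ℕ.≤-trans (ℕ.n≤1+n _) (ℕ.≤-reflexive (sym (toℕ-fromℕ m)))

    start : ∀ j → ∃[ c ] arc c ≢ j × arc (next c) ≡ j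
    start zero = fromℕ m ,
      (λ e₀ → contradiction (trans (sym (arc-last last≤m)) e₀) λ ()) ,
      cong arc (next-fromℕ m)
    start (suc j) = c , (λ e₀ → inject₁≢suc (trans (sym (trans (cong (arcAt (suc β)) c≡) (arcAt-odd j))) e₀)) , arc-next
      where
      c<m : suc (toℕ j + toℕ j) < m
      c<m = s≤s (s≤s (≤-trans (double≤ j) (ℕ.n≤1+n _)))
      -- Arc `inject₁ j` consists of the edges 2j and 2j + 1, so arc `suc j` begins just after
      -- position 2j + 1.
      c : Fin (suc m)
      c = fromℕ< (ℕ.m<n⇒m<1+n c<m)
      c≡ : toℕ c ≡ suc (toℕ j + toℕ j)
      c≡ = toℕ-fromℕ< (ℕ.m<n⇒m<1+n c<m)
      inject₁≢suc : inject₁ j ≢ suc j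
      inject₁≢suc e₀ = ℕ.m≢1+m+n (toℕ j) {0} (trans (sym (toℕ-inject₁ j)) (trans (cong toℕ e₀) (cong suc (sym (ℕ.+-identityʳ _)))))
      arc-next : arc (next c) ≡ suc j
      arc-next with next-cases c
      ... | inj₁ e₁ = trans (cong (arcAt (suc β)) (trans e₁ (cong suc c≡))) (arcAt-even j)
      ... | inj₂ (e₂ , _) = contradiction (trans (sym c≡) (trans (cong toℕ e₂) (toℕ-fromℕ m))) (ℕ.<⇒≢ c<m)

    private
      arcEnd< : ∀ (j : Fin (suc (suc β))) → toℕ j < suc β → suc (suc (toℕ j + toℕ j)) < suc m
      arcEnd< j j< = s≤s (s≤s (s≤s (≤-trans (ℕ.+-mono-≤ (ℕ.≤-pred j<) (ℕ.≤-pred j<))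
        (≤-trans (ℕ.m≤m+n (β + β) e) (ℕ.n≤1+n _)))))

    -- A two-edge arc j ends at position 2j + 2; the last arc closes the cycle and ends at `zero`.
    arcEnd : Fin (suc (suc β)) → Fin (suc m)
    arcEnd j with toℕ j <? suc β
    ... | yes j< = fromℕ< (arcEnd< j j<)
    ... | no _ = zero

    arcEnd-next : ∀ c → arc c ≢ arc (next c) → next c ≡ arcEnd (arc c)
    arcEnd-next c ne with next-cases c
    ... | inj₁ e₁ with arcAt-jump (suc β) (toℕ c) (subst (λ x → arc c ≢ arcAt (suc β) x) e₁ ne)
    ...   | lt , e₂ with toℕ (arc c) <? suc β
    ...     | yes lt′ = toℕ-injective (trans e₁ (trans e₂ (sym (toℕ-fromℕ< (arcEnd< (arc c) lt′)))))
    ...     | no ¬lt = contradiction lt ¬lt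
    arcEnd-next c ne | inj₂ (e₁ , e₂) with toℕ (arc c) <? suc β
    ... | no _ = e₂
    ... | yes lt = contradiction (trans (cong toℕ (arc-last {toℕ c} (subst (λ d → suc (suc (β + β + e)) ≤ toℕ d) (sym e₁) last≤m))) (toℕ-fromℕ (suc β)))
      (ℕ.<⇒≢ lt)

  -- The upper bound

  twiceEdges≤n² : ∀ {n} (L : EdgeSet n) → 2 * length (edges L) ≤ n * n
  twiceEdges≤n² {n} L = subst₂ _≤_ (ℕ.+-identityʳ _)
    (trans (length-cartesianProductWith _,_ (allFin n) (allFin n)) (cong₂ _*_ (length-allFin n) (length-allFin n)))
    (AtLeast-bound {zs = List.[]} (manyDarts L) (λ _ → ∈-cartesianProduct⁺ (∈-allFin _) (∈-allFin _)) [] λ ())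

  -- 2k times the bound |E| ≤ n (k/2 + 5/2 − 1/k) + 3k², with the negative term
  -- moved to the left.
  Sparse : ∀ {n k} → CriticalTrussOn n k → Set
  Sparse {n} {k} T = k * (2 * ∣E∣ (graph T)) + 2 * n ≤ n * (k * k + 5 * k) + 6 * (k * k * k)

  -- The trivial bound of n² darts suffices: for n ≤ 2k + 1 it exceeds the main term by at most nk²
  -- after multiplication by k, and the cubic term absorbs this.
  smallTruss : ∀ {n k} (T : CriticalTrussOn n k) → 2 ≤ k → n ≤ 2 * k + 1 → Sparse T
  smallTruss {n} {suc (suc κ)} T (s≤s (s≤s z≤n)) n≤ = begin
    k * (2 * ∣E∣ (graph T)) + 2 * n   ≤⟨ ℕ.+-monoˡ-≤ (2 * n) (ℕ.*-monoʳ-≤ k (≤-trans (twiceEdges≤n² (E (graph T))) (ℕ.*-monoʳ-≤ n n≤))) ⟩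
    k * (n * (2 * k + 1)) + 2 * n     ≤⟨ ℕ.m≤m+n _ (n * (4 * κ + 6)) ⟩
    k * (n * (2 * k + 1)) + 2 * n + n * (4 * κ + 6) ≡⟨ split n κ ⟩
    n * (k * k + 5 * k) + n * (k * k) ≤⟨ ℕ.+-monoʳ-≤ (n * (k * k + 5 * k)) (ℕ.*-monoˡ-≤ (k * k) n≤) ⟩
    n * (k * k + 5 * k) + (2 * k + 1) * (k * k) ≤⟨ ℕ.m≤m+n _ ((4 * κ + 7) * (k * k)) ⟩
    n * (k * k + 5 * k) + (2 * k + 1) * (k * k) + (4 * κ + 7) * (k * k) ≡⟨ collect n κ ⟩
    n * (k * k + 5 * k) + 6 * (k * k * k) ∎
    where
    open ℕ.≤-Reasoning
    k = 2 + κ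
    split : ∀ n κ → (2 + κ) * (n * (2 * (2 + κ) + 1)) + 2 * n + n * (4 * κ + 6)
                    ≡ n * ((2 + κ) * (2 + κ) + 5 * (2 + κ)) + n * ((2 + κ) * (2 + κ))
    split = solve-∀
    collect : ∀ n κ → n * ((2 + κ) * (2 + κ) + 5 * (2 + κ)) + (2 * (2 + κ) + 1) * ((2 + κ) * (2 + κ)) + (4 * κ + 7) * ((2 + κ) * (2 + κ))
                      ≡ n * ((2 + κ) * (2 + κ) + 5 * (2 + κ)) + 6 * ((2 + κ) * (2 + κ) * (2 + κ))
    collect = solve-∀

  -- A two-edge arc accounts for k vertices and (k² + 5k - 2)/2 edges, that is k/2 + 5/2 - 1/k per
  -- vertex. Each surplus cycle vertex brings k + 1 edges: two to hubs, one on the cycle, κ to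
  -- locals. In the scaled inequality the excess is at most ek² < k³.
  chainTruss : ∀ κ β e → e < 2 + κ → Σ[ T ∈ CriticalTrussOn (2 + ((2 + β) * (2 + κ) + e)) (2 + κ) ] Sparse T
  chainTruss κ β e e<k = subst (λ n → Σ[ T ∈ CriticalTrussOn n (2 + κ) ] Sparse T) (order≡ κ β e) (truss , sparse)
    where
    open Arcs β e
    open Chain κ m (2 + β) (s≤s (s≤s (s≤s z≤n))) arc long start
    open ℕ.≤-Reasoning
    k = 2 + κ
    b = 2 + β
    E₂ = 2 * ∣E∣ (graph truss)

    order≡ : ∀ κ β e → 2 + (suc (3 + (β + β + e)) + (2 + β) * κ) ≡ 2 + ((2 + β) * (2 + κ) + e)
    order≡ = solve-∀

    count : E₂ + 2 * b ≤ b * (k * k + 5 * k) + e * (2 * k + 2)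
    count = ℕ.+-cancelʳ-≤ (b * κ) _ _ (begin
      E₂ + 2 * b + b * κ   ≡⟨ swap-last E₂ (2 * b) (b * κ) ⟩
      E₂ + b * κ + 2 * b   ≤⟨ ℕ.+-monoˡ-≤ (2 * b) (edgeCount arcEnd arcEnd-next) ⟩
      2 * (2 * suc m + (2 * (b * κ) + (suc m + (suc m * κ + b * κ)))) + b * κ * κ + 2 * b ≡⟨ expand κ β e ⟩
      b * (k * k + 5 * k) + e * (2 * k + 2) + b * κ ∎)
      where
      swap-last : ∀ x y z → x + y + z ≡ x + z + y
      swap-last = solve-∀
      expand : ∀ κ β e → 2 * (2 * suc (3 + (β + β + e)) + (2 * ((2 + β) * κ) + (suc (3 + (β + β + e)) + (suc (3 + (β + β + e)) * κ + (2 + β) * κ)))) + (2 + β) * κ * κ + 2 * (2 + β)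
               ≡ (2 + β) * ((2 + κ) * (2 + κ) + 5 * (2 + κ)) + e * (2 * (2 + κ) + 2) + (2 + β) * κ
      expand = solve-∀

    sparse : Sparse truss
    sparse = begin
      k * E₂ + 2 * size                                     ≡⟨ regroup κ β e E₂ ⟩
      k * (E₂ + 2 * b) + (4 + 2 * e)                         ≤⟨ ℕ.+-monoˡ-≤ (4 + 2 * e) (ℕ.*-monoʳ-≤ k count) ⟩
      k * (b * (k * k + 5 * k) + e * (2 * k + 2)) + (4 + 2 * e) ≤⟨ ℕ.m≤m+n _ rest ⟩
      k * (b * (k * k + 5 * k) + e * (2 * k + 2)) + (4 + 2 * e) + rest ≡⟨ collect κ β e ⟩
      size * (k * k + 5 * k) + e * (k * k)                  ≤⟨ ℕ.+-monoʳ-≤ (size * (k * k + 5 * k)) (ℕ.*-monoˡ-≤ (k * k) (ℕ.<⇒≤ e<k)) ⟩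
      size * (k * k + 5 * k) + k * (k * k)                  ≤⟨ ℕ.+-monoʳ-≤ (size * (k * k + 5 * k)) (ℕ.m≤m+n (k * (k * k)) (5 * (k * (k * k)))) ⟩
      size * (k * k + 5 * k) + 6 * (k * (k * k))            ≡⟨ cong (λ x → size * (k * k + 5 * k) + 6 * x) (sym (ℕ.*-assoc k k k)) ⟩
      size * (k * k + 5 * k) + 6 * (k * k * k)              ∎
      where
      rest : ℕ
      rest = 2 * (κ * κ) + 18 * κ + 24 + e * (4 + 3 * κ)
      regroup : ∀ κ β e x → (2 + κ) * x + 2 * (2 + (suc (3 + (β + β + e)) + (2 + β) * κ)) ≡ (2 + κ) * (x + 2 * (2 + β)) + (4 + 2 * e)
      regroup = solve-∀
      collect : ∀ κ β e → (2 + κ) * ((2 + β) * ((2 + κ) * (2 + κ) + 5 * (2 + κ)) + e * (2 * (2 + κ) + 2)) + (4 + 2 * e) + (2 * (κ * κ) + 18 * κ + 24 + e * (4 + 3 * κ))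
                ≡ (2 + (suc (3 + (β + β + e)) + (2 + β) * κ)) * ((2 + κ) * (2 + κ) + 5 * (2 + κ)) + e * ((2 + κ) * (2 + κ))
      collect = solve-∀

  joinTruss : ∀ {n κ} → (2 + κ) + 4 ≤ n → CriticalTrussOn n (2 + κ)
  joinTruss {n} {κ} k+4≤n with r , refl ← ℕ.m≤n⇒∃[o]m+o≡n k+4≤n =
    subst (λ n → CriticalTrussOn n (2 + κ)) (order≡ κ r) (Join.truss κ (3 + r) (s≤s (s≤s (s≤s z≤n))))
    where
    order≡ : ∀ κ r → 2 + κ + suc (3 + r) ≡ 2 + κ + 4 + r
    order≡ = solve-∀

  sparseTruss : ∀ {n k} → 2 ≤ k → k + 4 ≤ n → Σ[ T ∈ CriticalTrussOn n k ] Sparse T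
  sparseTruss {n} {suc (suc κ)} 2≤k@(s≤s (s≤s z≤n)) k+4≤n with n ≤? 2 * (2 + κ) + 1
  ... | yes n≤ = joinTruss k+4≤n , smallTruss (joinTruss k+4≤n) 2≤k n≤
  -- Here r = n - (2k + 2); division by k yields the arcs beyond the obligatory two and the surplus
  -- e.
  ... | no n≰ with r , refl ← ℕ.m≤n⇒∃[o]m+o≡n (ℕ.≰⇒> n≰) with r divMod (2 + κ)
  ...   | result q e refl = subst (λ n → Σ[ T ∈ CriticalTrussOn n (2 + κ) ] Sparse T) (order≡ κ q (toℕ e))
    (chainTruss κ q (toℕ e) (toℕ<n e))
    where
    order≡ : ∀ κ q e → 2 + ((2 + q) * (2 + κ) + e) ≡ suc (2 * (2 + κ) + 1) + (e + q * (2 + κ))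
    order≡ = solve-∀

-- Passage to the rationals

open import Data.Integer as ℤ using (+_)
open import Data.Nat using (>-nonZero) renaming (_≤_ to _≤ℕ_; _+_ to _+ℕ_; _*_ to _*ℕ_)
open import Data.Rational using (ℚ; 0ℚ; 1ℚ; ½; _/_; _+_; _-_; _*_; -_; _≤_; _<_; nonNegative; fromℚᵘ; toℚᵘ)

-- Identities of fractions are settled by cross-multiplication on unnormalised rationals, free of
-- reduction to lowest terms, and carried over by `fromℚᵘ`.
fromℚᵘ-homo-+ : ∀ p q → fromℚᵘ (p ℚᵘ.+ q) ≡ fromℚᵘ p + fromℚᵘ q
fromℚᵘ-homo-+ p q = toℚᵘ-injective (begin-equality
  toℚᵘ (fromℚᵘ (p ℚᵘ.+ q))               ≃⟨ toℚᵘ-fromℚᵘ (p ℚᵘ.+ q) ⟩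
  p ℚᵘ.+ q                               ≃⟨ ℚᵘₚ.+-cong (toℚᵘ-fromℚᵘ p) (toℚᵘ-fromℚᵘ q) ⟨
  toℚᵘ (fromℚᵘ p) ℚᵘ.+ toℚᵘ (fromℚᵘ q)   ≃⟨ ℚₚ.toℚᵘ-homo-+ (fromℚᵘ p) (fromℚᵘ q) ⟨
  toℚᵘ (fromℚᵘ p + fromℚᵘ q)             ∎)
  where open ℚᵘₚ.≤-Reasoning

fromℚᵘ-homo-* : ∀ p q → fromℚᵘ (p ℚᵘ.* q) ≡ fromℚᵘ p * fromℚᵘ q
fromℚᵘ-homo-* p q = toℚᵘ-injective (begin-equality
  toℚᵘ (fromℚᵘ (p ℚᵘ.* q))               ≃⟨ toℚᵘ-fromℚᵘ (p ℚᵘ.* q) ⟩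
  p ℚᵘ.* q                               ≃⟨ ℚᵘₚ.*-cong (toℚᵘ-fromℚᵘ p) (toℚᵘ-fromℚᵘ q) ⟨
  toℚᵘ (fromℚᵘ p) ℚᵘ.* toℚᵘ (fromℚᵘ q)   ≃⟨ ℚₚ.toℚᵘ-homo-* (fromℚᵘ p) (fromℚᵘ q) ⟨
  toℚᵘ (fromℚᵘ p * fromℚᵘ q)             ∎)
  where open ℚᵘₚ.≤-Reasoning

fromℚᵘ-mono-≤ : ∀ {p q} → p ℚᵘ.≤ q → fromℚᵘ p ≤ fromℚᵘ q
fromℚᵘ-mono-≤ {p} {q} p≤q = toℚᵘ-cancel-≤ (begin
  toℚᵘ (fromℚᵘ p) ≃⟨ toℚᵘ-fromℚᵘ p ⟩
  p               ≤⟨ p≤q ⟩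
  q               ≃⟨ toℚᵘ-fromℚᵘ q ⟨
  toℚᵘ (fromℚᵘ q) ∎)
  where open ℚᵘₚ.≤-Reasoning

ι-+ : ∀ a b → ι (a +ℕ b) ≡ ι a + ι b
ι-+ a b = trans (fromℚᵘ-cong {mkℚᵘ (+ (a +ℕ b)) 0} {mkℚᵘ (+ a) 0 ℚᵘ.+ mkℚᵘ (+ b) 0}
  (*≡* (cong (ℤ._* + 1) (cong₂ ℤ._+_ (sym (ℤₚ.*-identityʳ (+ a))) (sym (ℤₚ.*-identityʳ (+ b)))))))
  (fromℚᵘ-homo-+ (mkℚᵘ (+ a) 0) (mkℚᵘ (+ b) 0))

ι-* : ∀ a b → ι (a *ℕ b) ≡ ι a * ι b
ι-* a b = trans (fromℚᵘ-cong {mkℚᵘ (+ (a *ℕ b)) 0} {mkℚᵘ (+ a) 0 ℚᵘ.* mkℚᵘ (+ b) 0}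
  (*≡* (cong (ℤ._* (+ 1)) (ℤₚ.pos-* a b))))
  (fromℚᵘ-homo-* (mkℚᵘ (+ a) 0) (mkℚᵘ (+ b) 0))

ι-mono-≤ : ∀ {a b} → a ≤ℕ b → ι a ≤ ι b
ι-mono-≤ {a} {b} a≤b = fromℚᵘ-mono-≤ {mkℚᵘ (+ a) 0} {mkℚᵘ (+ b) 0} (*≤* (ℤₚ.*-monoʳ-≤-nonNeg (+ 1) (ℤ.+≤+ a≤b)))

k/2≡ : ∀ k → + k / 2 ≡ ι k * ½
k/2≡ k = trans (fromℚᵘ-cong {mkℚᵘ (+ k) 1} {mkℚᵘ (+ k) 0 ℚᵘ.* mkℚᵘ (+ 1) 1}
  (*≡* (cong (ℤ._* + 2) (sym (ℤₚ.*-identityʳ (+ k))))))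
  (fromℚᵘ-homo-* (mkℚᵘ (+ k) 0) (mkℚᵘ (+ 1) 1))

k*1/k≡1 : ∀ κ → ι (suc κ) * (+ 1 / suc κ) ≡ 1ℚ
k*1/k≡1 κ = trans (sym (fromℚᵘ-homo-* (mkℚᵘ (+ suc κ) 0) (mkℚᵘ (+ 1) κ)))
  (fromℚᵘ-cong {mkℚᵘ (+ suc κ) 0 ℚᵘ.* mkℚᵘ (+ 1) κ} {mkℚᵘ (+ 1) 0}
    (*≡* (cong (λ x → + suc x) (eq κ))))
  where
  eq : ∀ κ → κ *ℕ 1 *ℕ 1 ≡ κ +ℕ 0 +ℕ 0
  eq = solve-∀

0≤ι : ∀ a → 0ℚ ≤ ι a
0≤ι a = ι-mono-≤ {0} {a} z≤n

0≤* : ∀ {p q} → 0ℚ ≤ p → 0ℚ ≤ q → 0ℚ ≤ p * q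
0≤* {p} {q} 0≤p 0≤q = ℚₚ.nonNegative⁻¹ (p * q)
  {{ℚₚ.nonNeg*nonNeg⇒nonNeg p {{nonNegative 0≤p}} q {{nonNegative 0≤q}}}}

x≤x+y : ∀ x {y} → 0ℚ ≤ y → x ≤ x + y
x≤x+y x {y} 0≤y = subst (_≤ x + y) (ℚₚ.+-identityʳ x) (ℚₚ.+-monoʳ-≤ x 0≤y)

five-halves : ℚ
five-halves = + 5 / 2

three : ℚ
three = + 3 / 1

lower-ℚ : ∀ n k m → n *ℕ (k +ℕ 2) ≤ℕ 2 *ℕ m → ι n * ((+ k / 2) + 1ℚ) ≤ ι m
lower-ℚ n k m le = subst₂ _≤_
  (trans (cong (_* ½) (trans (ι-* n (k +ℕ 2)) (cong (ι n *_) (ι-+ k 2))))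
    (trans (shape (ι n) (ι k)) (cong (λ x → ι n * (x + 1ℚ)) (sym (k/2≡ k)))))
  (trans (cong (_* ½) (ι-* 2 m)) (halve (ι m)))
  (ℚₚ.*-monoʳ-≤-nonNeg ½ (ι-mono-≤ le))
  where
  open +-*-Solver
  shape : ∀ ν κ → (ν * (κ + ι 2)) * ½ ≡ ν * (κ * ½ + 1ℚ)
  shape = solve 2 (λ ν κ → (ν :* (κ :+ con (ι 2))) :* con ½ := ν :* (κ :* con ½ :+ con 1ℚ)) refl
  halve : ∀ μ → ι 2 * μ * ½ ≡ μ
  halve = solve 1 (λ μ → con (ι 2) :* μ :* con ½ := μ) refl

module _ (n κ : ℕ) where
  private
    k = suc κ
    K = ι k
    N = ι n
    y = + 1 / k
    ky≡1 = k*1/k≡1 κ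

    0≤y : 0ℚ ≤ y
    0≤y = fromℚᵘ-mono-≤ {mkℚᵘ (+ 0) 0} {mkℚᵘ (+ 1) κ} (*≤* (ℤ.+≤+ z≤n))

  upper-ℚ : ∀ m → k *ℕ (2 *ℕ m) +ℕ 2 *ℕ n ≤ℕ n *ℕ (k *ℕ k +ℕ 5 *ℕ k) +ℕ 6 *ℕ (k *ℕ k *ℕ k) →
            ι m ≤ N * ((+ k / 2) + five-halves - y) + three * (K * K)
  -- Division by 2k is multiplication by `½ * y`; subtracting `N * y` then cancels the term 2n on
  -- the left.
  upper-ℚ m le = subst₂ _≤_ left right (ℚₚ.+-monoˡ-≤ (- (N * y)) (ℚₚ.*-monoʳ-≤-nonNeg (½ * y) {{nonNegative (0≤* (ℚₚ.nonNegative⁻¹ ½) 0≤y)}} le-ℚ))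
    where
    open +-*-Solver
    le-ℚ : K * (ι 2 * ι m) + ι 2 * N ≤ N * (K * K + ι 5 * K) + ι 6 * (K * K * K)
    le-ℚ = subst₂ _≤_
      (trans (ι-+ (k *ℕ (2 *ℕ m)) (2 *ℕ n)) (cong₂ _+_ (trans (ι-* k (2 *ℕ m)) (cong (K *_) (ι-* 2 m))) (ι-* 2 n)))
      (trans (ι-+ (n *ℕ (k *ℕ k +ℕ 5 *ℕ k)) (6 *ℕ (k *ℕ k *ℕ k))) (cong₂ _+_
        (trans (ι-* n (k *ℕ k +ℕ 5 *ℕ k)) (cong (N *_) (trans (ι-+ (k *ℕ k) (5 *ℕ k)) (cong₂ _+_ (ι-* k k) (ι-* 5 k)))))
        (trans (ι-* 6 (k *ℕ k *ℕ k)) (cong (ι 6 *_) (trans (ι-* (k *ℕ k) k) (cong (_* K) (ι-* k k)))))))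
      (ι-mono-≤ le)
    left : (K * (ι 2 * ι m) + ι 2 * N) * (½ * y) + - (N * y) ≡ ι m
    left = trans (collect K (ι m) N y) (trans (cong (ι m *_) ky≡1) (ℚₚ.*-identityʳ (ι m)))
      where
      collect : ∀ K M N y → (K * (ι 2 * M) + ι 2 * N) * (½ * y) + - (N * y) ≡ M * (K * y)
      collect = solve 4 (λ K M N y → (K :* (con (ι 2) :* M) :+ con (ι 2) :* N) :* (con ½ :* y) :+ :- (N :* y) := M :* (K :* y)) refl
    right : (N * (K * K + ι 5 * K) + ι 6 * (K * K * K)) * (½ * y) + - (N * y)
            ≡ N * ((+ k / 2) + five-halves - y) + three * (K * K)
    -- The ring solver treats `y` as a free variable, so the factors are first grouped as `K * y`,
    -- which is then replaced by 1.
    right = trans (collect K N y (K * y) refl) (trans (cong (λ z → N * (K * z * ½ + five-halves * z - y) + three * (K * K * z)) ky≡1)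
      (trans (simplify K N y) (cong (λ z → N * (z + five-halves - y) + three * (K * K)) (sym (k/2≡ k)))))
      where
      collect : ∀ K N y z → z ≡ K * y → (N * (K * K + ι 5 * K) + ι 6 * (K * K * K)) * (½ * y) + - (N * y)
                ≡ N * (K * z * ½ + five-halves * z - y) + three * (K * K * z)
      collect K N y _ refl = solve 3 (λ K N y → (N :* (K :* K :+ con (ι 5) :* K) :+ con (ι 6) :* (K :* K :* K)) :* (con ½ :* y) :+ :- (N :* y)
        := N :* (K :* (K :* y) :* con ½ :+ con five-halves :* (K :* y) :- y) :+ con three :* (K :* K :* (K :* y))) refl K N y
      simplify : ∀ K N y → N * (K * 1ℚ * ½ + five-halves * 1ℚ - y) + three * (K * K * 1ℚ)
                 ≡ N * (K * ½ + five-halves - y) + three * (K * K)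
      simplify = solve 3 (λ K N y → N :* (K :* con 1ℚ :* con ½ :+ con five-halves :* con 1ℚ :- y) :+ con three :* (K :* K :* con 1ℚ)
        := N :* (K :* con ½ :+ con five-halves :- y) :+ con three :* (K :* K)) refl

  -- With both constants equal to 3 the two sides differ by n(1/2 + 1/k), since 3 exceeds 5/2 - 1/k
  -- by just that factor.
  coarse-ℚ : N * ((+ k / 2) + five-halves - y) + three * (K * K) ≤ N * (+ k / 2) + three * (N + K * K)
  coarse-ℚ = subst (N * ((+ k / 2) + five-halves - y) + three * (K * K) ≤_) (collect N (+ k / 2) K y)
    (x≤x+y _ (0≤* (0≤ι n) (ℚₚ.≤-trans 0≤y (subst (y ≤_) (ℚₚ.+-comm y ½) (x≤x+y y (ℚₚ.nonNegative⁻¹ ½))))))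
    where
    open +-*-Solver
    collect : ∀ N x K y → N * (x + five-halves - y) + three * (K * K) + N * (½ + y) ≡ N * x + three * (N + K * K)
    collect = solve 4 (λ N x K y → N :* (x :+ con five-halves :- y) :+ con three :* (K :* K) :+ N :* (con ½ :+ y)
      := N :* x :+ con three :* (N :+ K :* K)) refl

theorem3p8 : Σ[ C ∈ ℚ ] Σ[ C′ ∈ ℚ ] (0ℚ < C) × (0ℚ < C′) ×
    ((k n : ℕ) (2≤k : 2 ≤ℕ k) → k +ℕ 4 ≤ℕ n →
    Σ[ m ∈ ℕ ] IsM* n k (fin m)
    × (ι n * ((+ k / 2) + 1ℚ) ≤ ι m)
    × (ι m ≤ ι n * ((+ k / 2) + (+ 5 / 2) - _/_ (+ 1) k {{>-nonZero (<⇒≤ 2≤k)}}) + C * (ι k * ι k))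
    × (ι n * ((+ k / 2) + (+ 5 / 2) - _/_ (+ 1) k {{>-nonZero (<⇒≤ 2≤k)}}) + C * (ι k * ι k)
    ≤ ι n * (+ k / 2) + C′ * (ι n + ι k * ι k)))
theorem3p8 = three , three , ℚₚ.positive⁻¹ three , ℚₚ.positive⁻¹ three , bounds
  where
  bounds : (k n : ℕ) (2≤k : 2 ≤ℕ k) → k +ℕ 4 ≤ℕ n →
    Σ[ m ∈ ℕ ] IsM* n k (fin m)
    × (ι n * ((+ k / 2) + 1ℚ) ≤ ι m)
    × (ι m ≤ ι n * ((+ k / 2) + (+ 5 / 2) - _/_ (+ 1) k {{>-nonZero (<⇒≤ 2≤k)}}) + three * (ι k * ι k))
    × (ι n * ((+ k / 2) + (+ 5 / 2) - _/_ (+ 1) k {{>-nonZero (<⇒≤ 2≤k)}}) + three * (ι k * ι k)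
    ≤ ι n * (+ k / 2) + three * (ι n + ι k * ι k))
  bounds k@(suc κ) n 2≤k k+4≤n with sparseTruss 2≤k k+4≤n
  ... | T , sparse with minimumExists T
  ...   | m , attained@(T₀ , size) , minimal = m , (attained , minimal) ,
    lower-ℚ n k m (subst (λ m → n *ℕ (k +ℕ 2) ≤ℕ 2 *ℕ m) size
      (lowerBound T₀ (ℕ.≤-trans (ℕ.+-monoʳ-≤ k (s≤s (s≤s (s≤s z≤n)))) k+4≤n))) ,
    upper-ℚ n κ m (ℕ.≤-trans (ℕ.+-monoˡ-≤ (2 *ℕ n) (ℕ.*-monoʳ-≤ k (ℕ.*-monoʳ-≤ 2 (minimal T)))) sparse) ,
    coarse-ℚ n κ
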